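{- Let $p$ be a prime with $p\equiv 1\pmod 4$. Then $\mathrm{NC}^9_{12p}$ is a connected cubic non-symmetric vertex-transitive non-Cayley graph of order $12p$, and $\mathrm{Aut}(\mathrm{NC}^9_{12p})\cong (S_3\times\mathbb{Z}_p)\rtimes\mathbb{Z}_4$.
   Context: For a group $H$ and subsets $R,L,S\subseteq H$ with $R=R^{ -1}$, $L=L^{ -1}$ and $1\notin R\cup L$, the bi-Cayley graph $\mathrm{BiCay}(H,R,L,S)$ has vertex set $\{h_0:h\in H\}\cup\{h_1:h\in H\}$ and edges $\{h_0,g_0\}$ for $gh^{ -1}\in R$, $\{h_1,g_1\}$ for $gh^{ -1}\in L$, and $\{h_0,g_1\}$ for $gh^{ -1}\in S$. For $p\equiv1\pmod 4$ prime, let $\lambda$ be an element of order $4$ in $\mathbb{Z}_p^*$, let $H=\langle a,b\mid a^2=b^2=(ab)^3=1\rangle\times\langle c\rangle\cong S_3\times\mathbb{Z}_p$ with $c$ of order $p$, and set $\mathrm{NC}^9_{12p}=\mathrm{BiCay}(H,\{ac,ac^{ -1}\},\{bc^{\lambda},bc^{ -\lambda}\},\{1\})$. A graph is vertex-transitive if its automorphism group is transitive on vertices, symmetric if it is transitive on arcs, and Cayley if its automorphism group contains a subgroup acting regularly on the vertex set. -}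

module Defs where

open import Level using (0ℓ)
open import Data.Nat using (ℕ; zero; suc; _+_; _*_; _∸_; _^_; _≤_; _<_; NonZero)
open import Data.Nat.DivMod using (_%_; m%n<n)
open import Data.Fin using (Fin; toℕ; fromℕ<) renaming (zero to f0; suc to fs)
open import Data.Product using (Σ; ∃; ∃-syntax; _×_; _,_; proj₁; proj₂)
open import Data.Sum using (_⊎_)
open import Relation.Binary.PropositionalEquality using (_≡_; _≢_)
open import Relation.Nullary using (¬_)
open import Function.Bundles using (_↔_; Inverse; mk↔ₛ′)
open import Function.Construct.Composition using (_↔-∘_)
open import Function.Construct.Identity using (↔-id)

modN : (n : ℕ) .{{_ : NonZero n}} → ℕ → Fin n
modN n m = fromℕ< (m%n<n m n)

module Zmod (n : ℕ) .{{_ : NonZero n}} where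
  _+ₙ_ : Fin n → Fin n → Fin n
  x +ₙ y = modN n (toℕ x + toℕ y)

  -ₙ_ : Fin n → Fin n
  -ₙ x = modN n (n ∸ toℕ x)

  0ₙ : Fin n
  0ₙ = modN n 0

open Zmod public

-- S₃ = ⟨a, b | a² = b² = (ab)³ = 1⟩, realised as ℤ₃ ⋊ ℤ₂:
-- (i , j) stands for rⁱ sʲ with r of order 3, s of order 2, s r s = r⁻¹.

S3 : Set
S3 = Fin 3 × Fin 2

_·S_ : S3 → S3 → S3
(i , f0)   ·S (k , l) = (_+ₙ_ 3 i k , l)
(i , fs j) ·S (k , l) = (_+ₙ_ 3 i (-ₙ_ 3 k) , _+ₙ_ 2 (fs j) l)

invS : S3 → S3
invS (i , f0)   = (-ₙ_ 3 i , f0)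
invS (i , fs j) = (i , fs j)

eS : S3
eS = (f0 , f0)

-- generators: a = s, b = r s  (both involutions, ab = r⁻¹ has order 3)
aS bS : S3
aS = (f0 , fs f0)
bS = (fs f0 , fs f0)

Hgrp : ℕ → Set
Hgrp p = S3 × Fin p

module HOps (p : ℕ) .{{_ : NonZero p}} where
  _·H_ : Hgrp p → Hgrp p → Hgrp p
  (s , x) ·H (t , y) = (s ·S t , _+ₙ_ p x y)

  invH : Hgrp p → Hgrp p
  invH (s , x) = (invS s , -ₙ_ p x)

  eH : Hgrp p
  eH = (eS , 0ₙ p)

open HOps public

module BiCayley {H : Set} (_∙_ : H → H → H) (inv : H → H)
                (R L S : H → Set) where
  Vert : Set
  Vert = Fin 2 × H

  Adj : Vert → Vert → Set
  Adj (f0 , h)    (f0 , g)    = R (g ∙ inv h)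
  Adj (fs f0 , h) (fs f0 , g) = L (g ∙ inv h)
  Adj (f0 , h)    (fs f0 , g) = S (g ∙ inv h)
  Adj (fs f0 , h) (f0 , g)    = S (h ∙ inv g)

BiCay : {H : Set} (_∙_ : H → H → H) (inv : H → H) (R L S : H → Set) →
        Σ Set (λ V → V → V → Set)
BiCay _∙_ inv R L S = BiCayley.Vert _∙_ inv R L S , BiCayley.Adj _∙_ inv R L S

module NCdef (p : ℕ) .{{_ : NonZero p}} (λ' : ℕ) where
  a c ac ac⁻¹ bcλ bc-λ : Hgrp p
  a    = (aS , 0ₙ p)
  c    = (eS , modN p 1)
  ac    = (aS , modN p 1)
  ac⁻¹  = (aS , -ₙ_ p (modN p 1))
  bcλ   = (bS , modN p λ')
  bc-λ  = (bS , -ₙ_ p (modN p λ'))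

  Rset Lset Sset : Hgrp p → Set
  Rset g = g ≡ ac ⊎ g ≡ ac⁻¹
  Lset g = g ≡ bcλ ⊎ g ≡ bc-λ
  Sset g = g ≡ eH p

  NC : Σ Set (λ V → V → V → Set)
  NC = BiCay (_·H_ p) (invH p) Rset Lset Sset

NC9-12p : (p : ℕ) .{{_ : NonZero p}} (λ' : ℕ) → Σ Set (λ V → V → V → Set)
NC9-12p p λ' = NCdef.NC p λ'

HasOrder4Mod : (p : ℕ) .{{_ : NonZero p}} → ℕ → Set
HasOrder4Mod p λ' =
  (λ' ^ 4) % p ≡ 1 × (∀ k → 1 ≤ k → k < 4 → (λ' ^ k) % p ≢ 1)

module GraphNotions (V : Set) (Adj : V → V → Set) where

  data Walk : V → V → Set where
    [] : ∀ {u} → Walk u u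
    _∷_ : ∀ {u w v} → Adj u w → Walk w v → Walk u v

  Connected : Set
  Connected = ∀ u v → Walk u v

  Cubic : Set
  Cubic = ∀ u → Σ (Fin 3 → V) λ nb →
            (∀ i → Adj u (nb i)) ×
            (∀ v → Adj u v → ∃[ i ] nb i ≡ v) ×
            (∀ i j → nb i ≡ nb j → i ≡ j)

  HasOrder : ℕ → Set
  HasOrder n = V ↔ Fin n

  record Automorphism : Set where
    field
      perm : V ↔ V
    open Inverse perm public using (to; from)
    field
      pres   : ∀ u v → Adj u v → Adj (to u) (to v)
      reflec : ∀ u v → Adj (to u) (to v) → Adj u v
  open Automorphism public

  _≈A_ : Automorphism → Automorphism → Set
  σ ≈A τ = ∀ v → to σ v ≡ to τ v

  idA : Automorphism
  idA = record { perm = ↔-id V ; pres = λ u v e → e ; reflec = λ u v e → e }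

  _∘A_ : Automorphism → Automorphism → Automorphism
  σ ∘A τ = record
    { perm   = perm σ ↔-∘ perm τ
    ; pres   = λ u v e → pres σ _ _ (pres τ u v e)
    ; reflec = λ u v e → reflec τ u v (reflec σ _ _ e)
    }

  VertexTransitive : Set
  VertexTransitive = ∀ u v → ∃[ σ ] to σ u ≡ v

  Symmetric : Set
  Symmetric = ∀ u v u' v' → Adj u v → Adj u' v' →
              ∃[ σ ] (to σ u ≡ u' × to σ v ≡ v')

  record Subgroup : Set₁ where
    field
      mem     : Automorphism → Set
      mem-id  : mem idA
      mem-∘   : ∀ {σ τ} → mem σ → mem τ → mem (σ ∘A τ)
      mem-inv : ∀ {σ} → mem σ → ∃[ τ ] (mem τ × (τ ∘A σ) ≈A idA)
  open Subgroup public

  RegularSubgroup : Subgroup → Set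
  RegularSubgroup G =
    (∀ u v → ∃[ σ ] (mem G σ × to σ u ≡ v)) ×
    (∀ σ τ u → mem G σ → mem G τ → to σ u ≡ to τ u → σ ≈A τ)

  Cayley : Set₁
  Cayley = ∃[ G ] RegularSubgroup G

  AutIso : (G : Set) → (G → G → G) → Set
  AutIso G _⊙_ = Σ (Automorphism → G) λ Ψ →
    (∀ σ τ → σ ≈A τ → Ψ σ ≡ Ψ τ) ×
    (∀ σ τ → Ψ (σ ∘A τ) ≡ Ψ σ ⊙ Ψ τ) ×
    (∀ σ τ → Ψ σ ≡ Ψ τ → σ ≈A τ) ×
    (∀ g → ∃[ σ ] Ψ σ ≡ g)

module SemiDirect (p : ℕ) .{{_ : NonZero p}} where
  IsAction : (Fin 4 → Hgrp p → Hgrp p) → Set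
  IsAction φ =
    (∀ i x y → φ i (_·H_ p x y) ≡ _·H_ p (φ i x) (φ i y)) ×
    (∀ i → Σ (Hgrp p → Hgrp p) λ ψ →
       (∀ x → ψ (φ i x) ≡ x) × (∀ x → φ i (ψ x) ≡ x)) ×
    (∀ i j x → φ (_+ₙ_ 4 i j) x ≡ φ i (φ j x))

  mulSD : (Fin 4 → Hgrp p → Hgrp p) →
          Hgrp p × Fin 4 → Hgrp p × Fin 4 → Hgrp p × Fin 4
  mulSD φ (h , i) (k , j) = (_·H_ p h (φ i k) , _+ₙ_ 4 i j)

open SemiDirect public

{-# OPTIONS --safe #-}
-- An automorphism is described by how it acts on walks, written as words in the spoke step S
-- and the steps N ± along the 2p-cycles.  A word moves a vertex by an element of S₃ and by the
-- image m + λ n of a Gaussian integer, which vanishes in ℤₚ only if p divides m² + n².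
-- For p ≠ 5, a walk N S N always lies on a closed reduced walk of length 10 and a straight walk
-- N N N never does; for p = 5, N S N lies on a closed reduced walk of length 8 and S N S does
-- not.  Hence automorphisms preserve the set of spokes, and in particular the graph is not
-- symmetric.  An automorphism preserving the spokes and fixing the two ends of a cycle edge is
-- the identity.  The automorphisms h ↦ h k⁻¹, together with the map δ exchanging the two sides
-- via a ↔ b, c ↦ c^λ, permute the pairs (vertex, direction) simply transitively, so they form
-- the whole group.  An automorphism taking 1₀ to 1₁ is δ or δ³, whose square fixes 1₀ without
-- being the identity; this rules out a regular subgroup.

module Submission where

open import Defs
open import Algebra.Bundles using (CommutativeRing; Group)
import Algebra.Properties.Group
import Algebra.Properties.Ring
open import Data.Empty using (⊥-elim)
open import Data.Fin using (Fin; toℕ; fromℕ<) renaming (zero to f0; suc to fs; opposite to other)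
open import Data.Fin.Properties using (all?)
import Data.Fin.Properties as Fin
open import Data.Integer as ℤ using (ℤ; 0ℤ; ∣_∣)
import Data.Integer.Properties as ℤ
open import Data.List using (List; []; _∷_; length; foldr)
open import Data.Nat using (ℕ; zero; suc; _+_; _*_; _∸_; _^_; _<_; z≤n; s≤s; NonZero; nonTrivial⇒n>1)
open import Data.Nat.DivMod
open import Data.Nat.Divisibility
open import Data.Nat.GeneralisedArithmetic using (fold; fold-+)
open import Data.Nat.Primality using (Prime; euclidsLemma; prime⇒nonTrivial; ¬prime[1])
import Data.Nat.Properties as ℕ
open import Data.Product using (∃; ∃-syntax; _×_; _,_; proj₁; proj₂)
open import Data.Product.Function.NonDependent.Propositional using (_×-↔_)
open import Data.Product.Properties using (≡-dec)
open import Data.Sign using (Sign; opposite) renaming (+ to pos; - to neg)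
import Data.Sign.Properties as Sign
open import Data.Sum using (_⊎_; inj₁; inj₂; [_,_]′) renaming (map to ⊎-map)
open import Function using (_∘_; id; _↔_; mk↔ₛ′; Inverse)
open import Function.Construct.Composition using (_↔-∘_)
open import Function.Construct.Identity using (↔-id)
open import Function.Construct.Symmetry using (↔-sym)
open import Level using (0ℓ)
open import Relation.Binary.Definitions using (DecidableEquality)
open import Relation.Binary.PropositionalEquality
open import Relation.Nullary using (¬_; Dec; yes; no; ¬?; _×-dec_; _⊎-dec_; _→-dec_)
open import Relation.Nullary.Decidable using (map′; toWitness)

-- The commutative ring of residues modulo n.

module Residues (n : ℕ) .{{_ : NonZero n}} where

  infixl 7 _⊛_
  infixl 6 _⊕_
  infix  8 ⊝_

  _⊕_ _⊛_ : Fin n → Fin n → Fin n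
  _⊕_ = _+ₙ_ n
  x ⊛ y = modN n (toℕ x * toℕ y)

  ⊝_ : Fin n → Fin n
  ⊝_ = -ₙ_ n

  𝟘 𝟙 : Fin n
  𝟘 = modN n 0
  𝟙 = modN n 1

  toℕ-modN : ∀ m → toℕ (modN n m) ≡ m % n
  toℕ-modN m = Fin.toℕ-fromℕ< (m%n<n m n)

  modN-cong : ∀ {k m} → k % n ≡ m % n → modN n k ≡ modN n m
  modN-cong {k} {m} eq = Fin.toℕ-injective (trans (toℕ-modN k) (trans eq (sym (toℕ-modN m))))

  modN-injective : ∀ {k m} → modN n k ≡ modN n m → k % n ≡ m % n
  modN-injective {k} {m} eq = trans (sym (toℕ-modN k)) (trans (cong toℕ eq) (toℕ-modN m))

  modN-toℕ : ∀ x → modN n (toℕ x) ≡ x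
  modN-toℕ x = Fin.toℕ-injective (trans (toℕ-modN (toℕ x)) (m<n⇒m%n≡m (Fin.toℕ<n x)))

  modN-+ : ∀ k m → modN n (k + m) ≡ modN n k ⊕ modN n m
  modN-+ k m rewrite toℕ-modN k | toℕ-modN m =
    modN-cong (%-distribˡ-+ k m n)

  modN-* : ∀ k m → modN n (k * m) ≡ modN n k ⊛ modN n m
  modN-* k m rewrite toℕ-modN k | toℕ-modN m =
    modN-cong (%-distribˡ-* k m n)

  ∣⇒modN≡𝟘 : ∀ {m} → n ∣ m → modN n m ≡ 𝟘
  ∣⇒modN≡𝟘 {m} n∣m = modN-cong (trans (n∣m⇒m%n≡0 m n n∣m) (sym (n∣m⇒m%n≡0 0 n (n ∣0))))

  modN≡𝟘⇒∣ : ∀ {m} → modN n m ≡ 𝟘 → n ∣ m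
  modN≡𝟘⇒∣ {m} eq = m%n≡0⇒n∣m m n (trans (modN-injective eq) (n∣m⇒m%n≡0 0 n (n ∣0)))

  ⊕-comm : ∀ x y → x ⊕ y ≡ y ⊕ x
  ⊕-comm x y = cong (modN n) (ℕ.+-comm (toℕ x) (toℕ y))

  ⊛-comm : ∀ x y → x ⊛ y ≡ y ⊛ x
  ⊛-comm x y = cong (modN n) (ℕ.*-comm (toℕ x) (toℕ y))

  ⊕-assoc : ∀ x y z → (x ⊕ y) ⊕ z ≡ x ⊕ (y ⊕ z)
  ⊕-assoc x y z = begin
    (x ⊕ y) ⊕ z                             ≡⟨ cong (x ⊕ y ⊕_) (modN-toℕ z) ⟨
    modN n (toℕ x + toℕ y) ⊕ modN n (toℕ z) ≡⟨ modN-+ (toℕ x + toℕ y) (toℕ z) ⟨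
    modN n (toℕ x + toℕ y + toℕ z)          ≡⟨ cong (modN n) (ℕ.+-assoc (toℕ x) (toℕ y) (toℕ z)) ⟩
    modN n (toℕ x + (toℕ y + toℕ z))        ≡⟨ modN-+ (toℕ x) (toℕ y + toℕ z) ⟩
    modN n (toℕ x) ⊕ (y ⊕ z)                ≡⟨ cong (_⊕ (y ⊕ z)) (modN-toℕ x) ⟩
    x ⊕ (y ⊕ z)                             ∎
    where open ≡-Reasoning

  ⊛-assoc : ∀ x y z → (x ⊛ y) ⊛ z ≡ x ⊛ (y ⊛ z)
  ⊛-assoc x y z = begin
    (x ⊛ y) ⊛ z                             ≡⟨ cong (x ⊛ y ⊛_) (modN-toℕ z) ⟨
    modN n (toℕ x * toℕ y) ⊛ modN n (toℕ z) ≡⟨ modN-* (toℕ x * toℕ y) (toℕ z) ⟨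
    modN n (toℕ x * toℕ y * toℕ z)          ≡⟨ cong (modN n) (ℕ.*-assoc (toℕ x) (toℕ y) (toℕ z)) ⟩
    modN n (toℕ x * (toℕ y * toℕ z))        ≡⟨ modN-* (toℕ x) (toℕ y * toℕ z) ⟩
    modN n (toℕ x) ⊛ (y ⊛ z)                ≡⟨ cong (_⊛ (y ⊛ z)) (modN-toℕ x) ⟩
    x ⊛ (y ⊛ z)                             ∎
    where open ≡-Reasoning

  ⊛-distribˡ-⊕ : ∀ x y z → x ⊛ (y ⊕ z) ≡ x ⊛ y ⊕ x ⊛ z
  ⊛-distribˡ-⊕ x y z = begin
    x ⊛ (y ⊕ z)                             ≡⟨ cong (_⊛ (y ⊕ z)) (modN-toℕ x) ⟨
    modN n (toℕ x) ⊛ (y ⊕ z)                ≡⟨ modN-* (toℕ x) (toℕ y + toℕ z) ⟨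
    modN n (toℕ x * (toℕ y + toℕ z))        ≡⟨ cong (modN n) (ℕ.*-distribˡ-+ (toℕ x) (toℕ y) (toℕ z)) ⟩
    modN n (toℕ x * toℕ y + toℕ x * toℕ z)  ≡⟨ modN-+ (toℕ x * toℕ y) (toℕ x * toℕ z) ⟩
    x ⊛ y ⊕ x ⊛ z                           ∎
    where open ≡-Reasoning

  ⊛-distribʳ-⊕ : ∀ x y z → (y ⊕ z) ⊛ x ≡ y ⊛ x ⊕ z ⊛ x
  ⊛-distribʳ-⊕ x y z = trans (⊛-comm (y ⊕ z) x)
    (trans (⊛-distribˡ-⊕ x y z) (cong₂ _⊕_ (⊛-comm x y) (⊛-comm x z)))

  ⊕-identityˡ : ∀ x → 𝟘 ⊕ x ≡ x
  ⊕-identityˡ x = begin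
    𝟘 ⊕ x                   ≡⟨ cong (𝟘 ⊕_) (modN-toℕ x) ⟨
    𝟘 ⊕ modN n (toℕ x)      ≡⟨ modN-+ 0 (toℕ x) ⟨
    modN n (toℕ x)          ≡⟨ modN-toℕ x ⟩
    x                       ∎
    where open ≡-Reasoning

  ⊛-identityˡ : ∀ x → 𝟙 ⊛ x ≡ x
  ⊛-identityˡ x = begin
    𝟙 ⊛ x                   ≡⟨ cong (𝟙 ⊛_) (modN-toℕ x) ⟨
    𝟙 ⊛ modN n (toℕ x)      ≡⟨ modN-* 1 (toℕ x) ⟨
    modN n (1 * toℕ x)      ≡⟨ cong (modN n) (ℕ.*-identityˡ (toℕ x)) ⟩
    modN n (toℕ x)          ≡⟨ modN-toℕ x ⟩
    x                       ∎
    where open ≡-Reasoning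

  ⊝-inverseʳ : ∀ x → x ⊕ ⊝ x ≡ 𝟘
  ⊝-inverseʳ x = begin
    x ⊕ ⊝ x                          ≡⟨ cong (_⊕ ⊝ x) (modN-toℕ x) ⟨
    modN n (toℕ x) ⊕ ⊝ x             ≡⟨ modN-+ (toℕ x) (n ∸ toℕ x) ⟨
    modN n (toℕ x + (n ∸ toℕ x))     ≡⟨ cong (modN n) (ℕ.m+[n∸m]≡n (ℕ.<⇒≤ (Fin.toℕ<n x))) ⟩
    modN n n                         ≡⟨ ∣⇒modN≡𝟘 ∣-refl ⟩
    𝟘                                ∎
    where open ≡-Reasoning

  commutativeRing : CommutativeRing 0ℓ 0ℓ
  commutativeRing = record
    { Carrier = Fin n ; _≈_ = _≡_ ; _+_ = _⊕_ ; _*_ = _⊛_ ; -_ = ⊝_ ; 0# = 𝟘 ; 1# = 𝟙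
    ; isCommutativeRing = record
      { isRing = record
        { +-isAbelianGroup = record
          { isGroup = record
            { isMonoid = record
              { isSemigroup = record
                { isMagma = record { isEquivalence = isEquivalence ; ∙-cong = cong₂ _⊕_ }
                ; assoc = ⊕-assoc }
              ; identity = ⊕-identityˡ , λ x → trans (⊕-comm x 𝟘) (⊕-identityˡ x) }
            ; inverse = (λ x → trans (⊕-comm (⊝ x) x) (⊝-inverseʳ x)) , ⊝-inverseʳ
            ; ⁻¹-cong = cong ⊝_ }
          ; comm = ⊕-comm }
        ; *-cong = cong₂ _⊛_
        ; *-assoc = ⊛-assoc
        ; *-identity = ⊛-identityˡ , λ x → trans (⊛-comm x 𝟙) (⊛-identityˡ x)
        ; distrib = ⊛-distribˡ-⊕ , ⊛-distribʳ-⊕ }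
      ; *-comm = ⊛-comm } }

  fromℤ : ℤ → Fin n
  fromℤ (ℤ.+ m)    = modN n m
  fromℤ ℤ.-[1+ m ] = ⊝ modN n (suc m)

  -- When `l` is a square root of -1, this is the kernel of the ring homomorphism from the Gaussian
  -- integers that sends i to `l`, evaluated at k + m i.
  Vanishes : Fin n → ℤ → ℤ → Set
  Vanishes l k m = fromℤ k ⊕ l ⊛ fromℤ m ≡ 𝟘

-- The group S₃

_≟S_ : DecidableEquality S3
_≟S_ = ≡-dec Fin._≟_ Fin._≟_

∀S3? : ∀ {P : S3 → Set} → (∀ s → Dec (P s)) → Dec (∀ s → P s)
∀S3? P? = map′ (λ f (i , j) → f i j) (λ f i j → f (i , j)) (all? λ i → all? λ j → P? (i , j))

·S-assoc : ∀ r s t → (r ·S s) ·S t ≡ r ·S (s ·S t)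
·S-assoc = toWitness {a? = ∀S3? λ r → ∀S3? λ s → ∀S3? λ t → _ ≟S _} _

·S-identityˡ : ∀ s → eS ·S s ≡ s
·S-identityˡ = toWitness {a? = ∀S3? λ s → _ ≟S _} _

·S-identityʳ : ∀ s → s ·S eS ≡ s
·S-identityʳ = toWitness {a? = ∀S3? λ s → _ ≟S _} _

·S-inverseˡ : ∀ s → invS s ·S s ≡ eS
·S-inverseˡ = toWitness {a? = ∀S3? λ s → _ ≟S _} _

·S-inverseʳ : ∀ s → s ·S invS s ≡ eS
·S-inverseʳ = toWitness {a? = ∀S3? λ s → _ ≟S _} _

-- The automorphism of S₃ exchanging a = s and b = r s.
αS : S3 → S3
αS (i , f0)   = (-ₙ_ 3 i , f0)
αS (i , fs j) = (_+ₙ_ 3 (-ₙ_ 3 i) (fs f0) , fs j)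

αS-homo : ∀ s t → αS (s ·S t) ≡ αS s ·S αS t
αS-homo = toWitness {a? = ∀S3? λ s → ∀S3? λ t → _ ≟S _} _

αS-involutive : ∀ s → αS (αS s) ≡ s
αS-involutive = toWitness {a? = ∀S3? λ s → _ ≟S _} _

genS : Fin 2 → S3
genS f0      = aS
genS (fs f0) = bS

-- Words over `Fin 2` name the side whose cycle edges multiply by the generator; `reach` follows
-- such a word through the graph.
S3-generated : ∀ s → ∃ λ w → foldr (λ i t → genS i ·S t) eS w ≡ s
S3-generated (f0 , f0)                = [] , refl
S3-generated (f0 , fs f0)             = f0 ∷ [] , refl
S3-generated (fs f0 , f0)             = fs f0 ∷ f0 ∷ [] , refl
S3-generated (fs f0 , fs f0)          = fs f0 ∷ [] , refl
S3-generated (fs (fs f0) , f0)        = f0 ∷ fs f0 ∷ [] , refl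
S3-generated (fs (fs f0) , fs f0)     = f0 ∷ fs f0 ∷ f0 ∷ [] , refl

-- Reduced walks as words

-- S is the spoke at a vertex; N ε is the edge along the cycle, traversed in direction ε.
data Step : Set where
  S : Step
  N : Sign → Step

N-injective : ∀ {ε ε′} → N ε ≡ N ε′ → ε ≡ ε′
N-injective refl = refl

reverse : Step → Step
reverse S     = S
reverse (N ε) = N (opposite ε)

reverse-involutive : ∀ t → reverse (reverse t) ≡ t
reverse-involutive S       = refl
reverse-involutive (N pos) = refl
reverse-involutive (N neg) = refl

_≟T_ : DecidableEquality Step
S   ≟T S    = yes refl
S   ≟T N _  = no λ ()
N _ ≟T S    = no λ ()
N ε ≟T N ε′ = map′ (cong N) N-injective (ε Sign.≟ ε′)

∀Step? : ∀ {P : Step → Set} → (∀ t → Dec (P t)) → Dec (∀ t → P t)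
∀Step? P? = map′
  (λ { (p , q , r) S → p ; (p , q , r) (N pos) → q ; (p , q , r) (N neg) → r })
  (λ f → f S , f (N pos) , f (N neg))
  (P? S ×-dec P? (N pos) ×-dec P? (N neg))

-- The index is the step taken just before the word, so that reducedness can be stated across the
-- point where a prefix meets its continuation.
data Reduced : Step → List Step → Set where
  []  : ∀ {t} → Reduced t []
  _∷_ : ∀ {t u w} → u ≢ reverse t → Reduced u w → Reduced t (u ∷ w)

N-straight : ∀ {ε} → N ε ≢ reverse (N ε)
N-straight {pos} ()
N-straight {neg} ()

-- The state (i , d , m , n) reached from (j , s , x) stands for the vertex
-- (i , d s , x + m + λ n), uniformly in s, x and p.
State : Set
State = Fin 2 × S3 × ℤ × ℤ

start : Fin 2 → State
start i = i , eS , 0ℤ , 0ℤ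

shift : Sign → ℤ → ℤ
shift pos = ℤ.suc
shift neg = ℤ.pred

move : Step → State → State
move S     (i     , d , m , n) = (other i , d , m , n)
move (N ε) (f0    , d , m , n) = (f0    , aS ·S d , shift ε m , n)
move (N ε) (fs f0 , d , m , n) = (fs f0 , bS ·S d , m , shift ε n)

moves : List Step → State → State
moves []      st = st
moves (t ∷ w) st = moves w (move t st)

Closed : (ℤ → ℤ → Set) → Fin 2 → State → Set
Closed Z i (j , d , m , n) = j ≡ i × d ≡ eS × Z m n

closed? : ∀ {Z : ℤ → ℤ → Set} → (∀ m n → Dec (Z m n)) → ∀ i st → Dec (Closed Z i st)
closed? Z? i (j , d , m , n) = j Fin.≟ i ×-dec d ≟S eS ×-dec Z? m n

-- A walk over the tree of reduced continuations of the last step `t`, with two branches at each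
-- level. It is decidable by finite search, unlike a quantifier over lists.
Avoids : (State → Set) → ℕ → Step → State → Set
Avoids P zero    t st = ¬ P st
Avoids P (suc k) t st = ∀ u → u ≢ reverse t → Avoids P k u (move u st)

avoids? : ∀ {P : State → Set} → (∀ st → Dec (P st)) → ∀ k t st → Dec (Avoids P k t st)
avoids? P? zero    t st = ¬? (P? st)
avoids? P? (suc k) t st =
  ∀Step? λ u → ¬? (u ≟T reverse t) →-dec avoids? P? k u (move u st)

avoids⇒¬ : ∀ P {k t w} st → Avoids P k t st → length w ≡ k → Reduced t w → ¬ P (moves w st)
avoids⇒¬ P st av refl []      = av
avoids⇒¬ P st av refl (_∷_ {u = u} u≢ r) = avoids⇒¬ P (move u st) (av u u≢) refl r

-- Every reduced walk N S N extends to a closed reduced walk of length 3 + len, whereas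
-- no reduced walk (flank , N , flank) does; so no automorphism maps an N-edge to a spoke.
record Obstruction (Z : ℤ → ℤ → Set) : Set where
  field
    len         : ℕ
    flank       : Sign → Step
    flank-N     : ∀ ε → N ε ≢ reverse (flank ε)
    N-flank     : ∀ ε → flank ε ≢ reverse (N ε)
    closable    : ∀ i ε ε′ → ∃ λ w → length w ≡ len × Reduced (N ε′) w ×
                  Closed Z i (moves (N ε ∷ S ∷ N ε′ ∷ w) (start i))
    notClosable : ∀ i ε w → length w ≡ len → Reduced (flank ε) w →
                  ¬ Closed Z i (moves (flank ε ∷ N ε ∷ flank ε ∷ w) (start i))

∀Sign? : ∀ {P : Sign → Set} → (∀ t → Dec (P t)) → Dec (∀ t → P t)
∀Sign? P? = map′ (λ { (p , q) pos → p ; (p , q) neg → q }) (λ f → f pos , f neg)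
  (P? pos ×-dec P? neg)

normSq : ℤ → ℤ → ℕ
normSq m n = ∣ m ∣ * ∣ m ∣ + ∣ n ∣ * ∣ n ∣

-- The norms m² + n² of the 10-step walks from N N N returning to the start in Fin 2 × S₃
-- are 4, 8, 20, 32, 40 and 100, all of them divisors of 1600 = 40².
Rough : ℤ → ℤ → Set
Rough m n = ¬ (normSq m n ∣ 1600)

rough? : ∀ m n → Dec (Rough m n)
rough? m n = ¬? (normSq m n ∣? 1600)

-- Since `Rough` does not mention p, one finite search covers every p other than 5. An exact return
-- with m = n = 0 would be detected as well, because 0 does not divide 1600.
generic-avoids : ∀ i ε → Avoids (Closed Rough i) 7 (N ε) (moves (N ε ∷ N ε ∷ N ε ∷ []) (start i))
generic-avoids = toWitness
  {a? = all? λ i → ∀Sign? λ ε →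
        avoids? (closed? rough? i) 7 (N ε) (moves (N ε ∷ N ε ∷ N ε ∷ []) (start i))} _

genericObstruction : ∀ {Z : ℤ → ℤ → Set} → Z 0ℤ 0ℤ → (∀ {m n} → Z m n → Rough m n) → Obstruction Z
genericObstruction {Z} z00 rough = record
  { len = 7
  ; flank = N
  ; flank-N = λ _ → N-straight
  ; N-flank = λ _ → N-straight
  ; closable = λ i ε ε′ → closing ε ε′ , refl , reduced ε ε′ , closed i ε ε′
  ; notClosable = λ i ε w eq r (j≡i , d≡e , z) →
      avoids⇒¬ (Closed Rough i) _ (generic-avoids i ε) eq r (j≡i , d≡e , rough z)
  }
  where
  -- The complete walk is the commutator of `N ε` with `S`, `N ε′`, `N ε′`, `S`. The latter only
  -- translates ℤₚ, since two cycle steps cancel in S₃, and therefore commutes with `N ε`.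
  closing : Sign → Sign → List Step
  closing ε ε′ = N ε′ ∷ S ∷ N (opposite ε) ∷ S ∷ N (opposite ε′) ∷ N (opposite ε′) ∷ S ∷ []

  reduced : ∀ ε ε′ → Reduced (N ε′) (closing ε ε′)
  reduced ε ε′ = N-straight ∷ (λ ()) ∷ (λ ()) ∷ (λ ()) ∷ (λ ()) ∷ N-straight ∷ (λ ()) ∷ []

  closed : ∀ i ε ε′ → Closed Z i (moves (N ε ∷ S ∷ N ε′ ∷ closing ε ε′) (start i))
  closed f0      pos pos = refl , refl , z00
  closed f0      pos neg = refl , refl , z00
  closed f0      neg pos = refl , refl , z00
  closed f0      neg neg = refl , refl , z00
  closed (fs f0) pos pos = refl , refl , z00
  closed (fs f0) pos neg = refl , refl , z00
  closed (fs f0) neg pos = refl , refl , z00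
  closed (fs f0) neg neg = refl , refl , z00

-- These close N S N because, for suitable signs, 2 ± 4λ or 4 ± 2λ vanishes in ℤ₅, where λ = ±2.
five-closing₁ five-closing₂ : Sign → Sign → List Step
five-closing₁ ε ε′ = N ε′ ∷ N ε′ ∷ N ε′ ∷ S ∷ N ε ∷ []
five-closing₂ ε ε′ = N ε′ ∷ S ∷ N ε ∷ N ε ∷ N ε ∷ []

five-reduced₁ : ∀ ε ε′ → Reduced (N ε′) (five-closing₁ ε ε′)
five-reduced₁ ε ε′ = N-straight ∷ N-straight ∷ N-straight ∷ (λ ()) ∷ (λ ()) ∷ []

five-reduced₂ : ∀ ε ε′ → Reduced (N ε′) (five-closing₂ ε ε′)
five-reduced₂ ε ε′ = N-straight ∷ (λ ()) ∷ (λ ()) ∷ N-straight ∷ N-straight ∷ []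

module FiveObstruction {Z : ℤ → ℤ → Set} (Z? : ∀ m n → Dec (Z m n)) where

  Closable : Set
  Closable = ∀ i ε ε′ →
    Closed Z i (moves (N ε ∷ S ∷ N ε′ ∷ five-closing₁ ε ε′) (start i)) ⊎
    Closed Z i (moves (N ε ∷ S ∷ N ε′ ∷ five-closing₂ ε ε′) (start i))

  closable? : Dec Closable
  closable? = all? λ i → ∀Sign? λ ε → ∀Sign? λ ε′ → closed? Z? i _ ⊎-dec closed? Z? i _

  NotClosable : Set
  NotClosable = ∀ i ε → Avoids (Closed Z i) 5 S (moves (S ∷ N ε ∷ S ∷ []) (start i))

  notClosable? : Dec NotClosable
  notClosable? = all? λ i → ∀Sign? λ ε → avoids? (closed? Z? i) 5 S _

  obstruction : Closable → NotClosable → Obstruction Z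
  obstruction cl ncl = record
    { len = 5
    ; flank = λ _ → S
    ; flank-N = λ _ ()
    ; N-flank = λ _ ()
    ; closable = λ i ε ε′ → closable i ε ε′ (cl i ε ε′)
    ; notClosable = λ i ε w eq r → avoids⇒¬ (Closed Z i) _ (ncl i ε) eq r
    }
    where
    closable : ∀ i ε ε′ → _ → ∃ λ w → length w ≡ 5 × Reduced (N ε′) w ×
               Closed Z i (moves (N ε ∷ S ∷ N ε′ ∷ w) (start i))
    closable i ε ε′ (inj₁ c) = five-closing₁ ε ε′ , refl , five-reduced₁ ε ε′ , c
    closable i ε ε′ (inj₂ c) = five-closing₂ ε ε′ , refl , five-reduced₂ ε ε′ , c

-- The field ℤₚ

∤2 : ∀ p → Prime p → p % 4 ≡ 1 → ¬ (p ∣ 2)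
∤2 p pr p≡1 p∣2 with p | ∣⇒≤ p∣2
∤2 p pr () p∣2 | 0 | _
∤2 p pr p≡1 p∣2 | 1 | _ = ¬prime[1] pr
∤2 p pr () p∣2 | 2 | _
... | suc (suc (suc _)) | s≤s (s≤s ())

module Field (p : ℕ) .{{_ : NonZero p}} (pr : Prime p) (p≡1 : p % 4 ≡ 1) where

  open Residues p public
  open CommutativeRing commutativeRing public
    using (ring; +-group; -‿inverseˡ)
    renaming (+-identityʳ to ⊕-identityʳ; *-identityʳ to ⊛-identityʳ; zeroˡ to ⊛-zeroˡ; zeroʳ to ⊛-zeroʳ)
  open Algebra.Properties.Ring ring public using (-‿+-comm; -‿distribˡ-*; -‿distribʳ-*; -1*x≈-x)
  open Algebra.Properties.Group +-group public using ()
    renaming (⁻¹-involutive to ⊝-involutive; inverseˡ-unique to ⊕-inverseˡ-unique;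
              \\-leftDividesʳ to ⊝x⊕[x⊕y]≡y; //-rightDividesˡ to [x⊕⊝y]⊕y≡x;
              ∙-cancelʳ to ⊕-cancelʳ; identityˡ-unique to ⊕-identityˡ-unique)

  ⊛-integral : ∀ {x y} → x ⊛ y ≡ 𝟘 → x ≡ 𝟘 ⊎ y ≡ 𝟘
  ⊛-integral {x} {y} eq = ⊎-map (zero-toℕ x) (zero-toℕ y)
    (euclidsLemma (toℕ x) (toℕ y) pr (modN≡𝟘⇒∣ eq))
    where
    zero-toℕ : ∀ z → p ∣ toℕ z → z ≡ 𝟘
    zero-toℕ z d = trans (sym (modN-toℕ z)) (∣⇒modN≡𝟘 d)

  x⊕x≡𝟘⇒x≡𝟘 : ∀ {x} → x ⊕ x ≡ 𝟘 → x ≡ 𝟘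
  x⊕x≡𝟘⇒x≡𝟘 {x} eq = [ ⊥-elim ∘ ∤2 p pr p≡1 ∘ modN≡𝟘⇒∣ , id ]′ (⊛-integral (begin
    modN p 2 ⊛ x      ≡⟨ cong (_⊛ x) (modN-+ 1 1) ⟩
    (𝟙 ⊕ 𝟙) ⊛ x       ≡⟨ ⊛-distribʳ-⊕ x 𝟙 𝟙 ⟩
    𝟙 ⊛ x ⊕ 𝟙 ⊛ x     ≡⟨ cong₂ _⊕_ (⊛-identityˡ x) (⊛-identityˡ x) ⟩
    x ⊕ x             ≡⟨ eq ⟩
    𝟘                 ∎))
    where open ≡-Reasoning

  x≡⊝x⇒x≡𝟘 : ∀ {x} → x ≡ ⊝ x → x ≡ 𝟘
  x≡⊝x⇒x≡𝟘 {x} eq = x⊕x≡𝟘⇒x≡𝟘 (trans (cong (x ⊕_) eq) (⊝-inverseʳ x))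

  𝟙≢𝟘 : 𝟙 ≢ 𝟘
  𝟙≢𝟘 eq = ¬prime[1] (subst Prime (∣1⇒≡1 (modN≡𝟘⇒∣ eq)) pr)

  -- With p = 4 q + 1, the number 1 + 2 q is (p + 1) / 2.
  ½ : Fin p
  ½ = modN p (1 + (p / 4) * 2)

  ½⊕½≡𝟙 : ½ ⊕ ½ ≡ 𝟙
  ½⊕½≡𝟙 = begin
    ½ ⊕ ½                                      ≡⟨ modN-+ (1 + q * 2) (1 + q * 2) ⟨
    modN p ((1 + q * 2) + (1 + q * 2))         ≡⟨ cong (modN p) lemma ⟩
    modN p (1 + p)                             ≡⟨ modN-+ 1 p ⟩
    𝟙 ⊕ modN p p                               ≡⟨ cong (𝟙 ⊕_) (∣⇒modN≡𝟘 ∣-refl) ⟩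
    𝟙 ⊕ 𝟘                                      ≡⟨ ⊕-identityʳ 𝟙 ⟩
    𝟙                                          ∎
    where
    open ≡-Reasoning
    q = p / 4
    lemma : (1 + q * 2) + (1 + q * 2) ≡ 1 + p
    lemma = begin
      suc (q * 2 + (1 + q * 2))    ≡⟨ cong suc (ℕ.+-suc (q * 2) (q * 2)) ⟩
      2 + (q * 2 + q * 2)          ≡⟨ cong (2 +_) (ℕ.*-distribˡ-+ q 2 2) ⟨
      1 + (1 + q * 4)              ≡⟨ cong (λ r → 1 + (r + q * 4)) p≡1 ⟨
      1 + (p % 4 + q * 4)          ≡⟨ cong suc (m≡m%n+[m/n]*n p 4) ⟨
      1 + p                        ∎

  [⊝x]⊛[⊝y] : ∀ x y → ⊝ x ⊛ ⊝ y ≡ x ⊛ y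
  [⊝x]⊛[⊝y] x y = begin
    ⊝ x ⊛ ⊝ y       ≡⟨ -‿distribˡ-* x (⊝ y) ⟨
    ⊝ (x ⊛ ⊝ y)     ≡⟨ cong ⊝_ (-‿distribʳ-* x y) ⟨
    ⊝ (⊝ (x ⊛ y))   ≡⟨ ⊝-involutive (x ⊛ y) ⟩
    x ⊛ y           ∎
    where open ≡-Reasoning

  s²≡𝟙⇒s≡⊝𝟙 : ∀ s → s ⊛ s ≡ 𝟙 → s ≢ 𝟙 → s ≡ ⊝ 𝟙
  s²≡𝟙⇒s≡⊝𝟙 s s² s≢𝟙 =
    [ (λ e → ⊥-elim (s≢𝟙 (trans (⊕-inverseˡ-unique s (⊝ 𝟙) e) (⊝-involutive 𝟙))))
    , ⊕-inverseˡ-unique s 𝟙 ]′ (⊛-integral {s ⊕ ⊝ 𝟙} {s ⊕ 𝟙} (begin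
      (s ⊕ ⊝ 𝟙) ⊛ (s ⊕ 𝟙)            ≡⟨ ⊛-distribʳ-⊕ (s ⊕ 𝟙) s (⊝ 𝟙) ⟩
      s ⊛ (s ⊕ 𝟙) ⊕ ⊝ 𝟙 ⊛ (s ⊕ 𝟙)    ≡⟨ cong₂ _⊕_ (⊛-distribˡ-⊕ s s 𝟙) (-1*x≈-x (s ⊕ 𝟙)) ⟩
      s ⊛ s ⊕ s ⊛ 𝟙 ⊕ ⊝ (s ⊕ 𝟙)      ≡⟨ cong (_⊕ ⊝ (s ⊕ 𝟙)) (cong₂ _⊕_ s² (⊛-identityʳ s)) ⟩
      𝟙 ⊕ s ⊕ ⊝ (s ⊕ 𝟙)              ≡⟨ cong (_⊕ ⊝ (s ⊕ 𝟙)) (⊕-comm 𝟙 s) ⟩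
      s ⊕ 𝟙 ⊕ ⊝ (s ⊕ 𝟙)              ≡⟨ ⊝-inverseʳ (s ⊕ 𝟙) ⟩
      𝟘                              ∎))
    where open ≡-Reasoning

  -- The square of `λ'` is itself a square root of 1, and it is not 1 because the order is 4. A
  -- field leaves only -1.
  order4⇒square≡-1 : ∀ λ' → HasOrder4Mod p λ' → modN p λ' ⊛ modN p λ' ≡ ⊝ 𝟙
  order4⇒square≡-1 λ' (λ⁴ , λᵏ) =
    trans (sym square) (s²≡𝟙⇒s≡⊝𝟙 (modN p (λ' ^ 2)) fourth λ²≢1)
    where
    1<p : 1 < p
    1<p = nonTrivial⇒n>1 p {{prime⇒nonTrivial pr}}
    1%p : 1 % p ≡ 1
    1%p = m<n⇒m%n≡m 1<p
    square : modN p (λ' ^ 2) ≡ modN p λ' ⊛ modN p λ'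
    square = trans (cong (modN p) (cong (λ' *_) (ℕ.*-identityʳ λ'))) (modN-* λ' λ')
    fourth : modN p (λ' ^ 2) ⊛ modN p (λ' ^ 2) ≡ 𝟙
    fourth = trans (sym (modN-* (λ' ^ 2) (λ' ^ 2)))
      (trans (cong (modN p) (sym (ℕ.^-distribˡ-+-* λ' 2 2))) (modN-cong (trans λ⁴ (sym 1%p))))
    λ²≢1 : modN p (λ' ^ 2) ≢ 𝟙
    λ²≢1 eq = λᵏ 2 (s≤s z≤n) (s≤s (s≤s (s≤s z≤n))) (trans (modN-injective eq) 1%p)

  fromℤ-suc : ∀ z → fromℤ (ℤ.suc z) ≡ 𝟙 ⊕ fromℤ z
  fromℤ-suc (ℤ.+ n)          = modN-+ 1 n
  fromℤ-suc ℤ.-[1+ zero ]    = sym (⊝-inverseʳ 𝟙)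
  fromℤ-suc ℤ.-[1+ suc n ]   = begin
    ⊝ y                          ≡⟨ ⊝x⊕[x⊕y]≡y (𝟙 ⊕ y) (⊝ y) ⟨
    ⊝ (𝟙 ⊕ y) ⊕ (𝟙 ⊕ y ⊕ ⊝ y)    ≡⟨ cong (⊝ (𝟙 ⊕ y) ⊕_) (⊕-assoc 𝟙 y (⊝ y)) ⟩
    ⊝ (𝟙 ⊕ y) ⊕ (𝟙 ⊕ (y ⊕ ⊝ y))  ≡⟨ cong (λ z → ⊝ (𝟙 ⊕ y) ⊕ (𝟙 ⊕ z)) (⊝-inverseʳ y) ⟩
    ⊝ (𝟙 ⊕ y) ⊕ (𝟙 ⊕ 𝟘)          ≡⟨ cong (⊝ (𝟙 ⊕ y) ⊕_) (⊕-identityʳ 𝟙) ⟩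
    ⊝ (𝟙 ⊕ y) ⊕ 𝟙                ≡⟨ ⊕-comm _ 𝟙 ⟩
    𝟙 ⊕ ⊝ (𝟙 ⊕ y)                ≡⟨ cong (λ z → 𝟙 ⊕ ⊝ z) (modN-+ 1 (suc n)) ⟨
    𝟙 ⊕ ⊝ modN p (suc (suc n))   ∎
    where
    open ≡-Reasoning
    y = modN p (suc n)

  signed : Sign → Fin p → Fin p
  signed pos x = x
  signed neg x = ⊝ x

  fromℤ-shift : ∀ ε z → fromℤ (shift ε z) ≡ signed ε 𝟙 ⊕ fromℤ z
  fromℤ-shift pos z = fromℤ-suc z
  fromℤ-shift neg z = begin
    fromℤ (ℤ.pred z)                   ≡⟨ ⊝x⊕[x⊕y]≡y 𝟙 _ ⟨
    ⊝ 𝟙 ⊕ (𝟙 ⊕ fromℤ (ℤ.pred z))       ≡⟨ cong (⊝ 𝟙 ⊕_) (fromℤ-suc (ℤ.pred z)) ⟨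
    ⊝ 𝟙 ⊕ fromℤ (ℤ.suc (ℤ.pred z))     ≡⟨ cong (λ y → ⊝ 𝟙 ⊕ fromℤ y) (ℤ.suc-pred z) ⟩
    ⊝ 𝟙 ⊕ fromℤ z                      ∎
    where open ≡-Reasoning

  fromℤ-square : ∀ z → fromℤ z ⊛ fromℤ z ≡ modN p (∣ z ∣ * ∣ z ∣)
  fromℤ-square (ℤ.+ n)    = sym (modN-* n n)
  fromℤ-square ℤ.-[1+ n ] = trans ([⊝x]⊛[⊝y] (modN p (suc n)) (modN p (suc n))) (sym (modN-* (suc n) (suc n)))

  ⊛-signed : ∀ ε x y → x ⊛ signed ε y ≡ signed ε (x ⊛ y)
  ⊛-signed pos x y = refl
  ⊛-signed neg x y = sym (-‿distribʳ-* x y)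

  signed-opposite : ∀ ε x → signed ε x ⊕ signed (opposite ε) x ≡ 𝟘
  signed-opposite pos x = ⊝-inverseʳ x
  signed-opposite neg x = -‿inverseˡ x

  signed-injective : ∀ {x} ε ε′ → x ≢ 𝟘 → signed ε x ≡ signed ε′ x → ε ≡ ε′
  signed-injective pos pos _  _  = refl
  signed-injective pos neg x≢ eq = ⊥-elim (x≢ (x≡⊝x⇒x≡𝟘 eq))
  signed-injective neg pos x≢ eq = ⊥-elim (x≢ (x≡⊝x⇒x≡𝟘 (sym eq)))
  signed-injective neg neg _  _  = refl

-- The obstruction for p = 5 and for all other primes.

vanishes? : ∀ p .{{_ : NonZero p}} l m n → Dec (Residues.Vanishes p l m n)
vanishes? p l m n = _ Fin.≟ _

-- Norms such as 20 are divisible by 5, so the norm argument says nothing here. The square roots of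
-- -1 in ℤ₅ are 2 and 3, and for each of them the search is run with the actual vanishing condition.
obstruction-5 : ∀ l → Residues._⊛_ 5 l l ≡ Residues.⊝_ 5 (Residues.𝟙 5) →
                Obstruction (Residues.Vanishes 5 l)
obstruction-5 f0 ()
obstruction-5 (fs f0) ()
obstruction-5 l@(fs (fs f0)) _ =
  obstruction (toWitness {a? = closable?} _) (toWitness {a? = notClosable?} _)
  where open FiveObstruction (vanishes? 5 l)
obstruction-5 l@(fs (fs (fs f0))) _ =
  obstruction (toWitness {a? = closable?} _) (toWitness {a? = notClosable?} _)
  where open FiveObstruction (vanishes? 5 l)
obstruction-5 (fs (fs (fs (fs f0)))) ()

module _ (p : ℕ) .{{_ : NonZero p}} (pr : Prime p) (p≡1 : p % 4 ≡ 1) where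

  open Field p pr p≡1

  -- From m = - l n it follows that m² = l² n² = - n² in ℤₚ.
  vanishes⇒∣norm : ∀ l → l ⊛ l ≡ ⊝ 𝟙 → ∀ m n → Vanishes l m n → p ∣ normSq m n
  vanishes⇒∣norm l l² m n z = modN≡𝟘⇒∣ (begin
    modN p (normSq m n)                                 ≡⟨ modN-+ (∣ m ∣ * ∣ m ∣) (∣ n ∣ * ∣ n ∣) ⟩
    modN p (∣ m ∣ * ∣ m ∣) ⊕ modN p (∣ n ∣ * ∣ n ∣)     ≡⟨ cong₂ _⊕_ (fromℤ-square m) (fromℤ-square n) ⟨
    x ⊛ x ⊕ y ⊛ y                                       ≡⟨ cong (λ w → w ⊛ w ⊕ y ⊛ y) (⊕-inverseˡ-unique x (l ⊛ y) z) ⟩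
    ⊝ (l ⊛ y) ⊛ ⊝ (l ⊛ y) ⊕ y ⊛ y                       ≡⟨ cong (_⊕ y ⊛ y) ([⊝x]⊛[⊝y] (l ⊛ y) (l ⊛ y)) ⟩
    (l ⊛ y) ⊛ (l ⊛ y) ⊕ y ⊛ y                           ≡⟨ cong (λ w → w ⊛ (l ⊛ y) ⊕ y ⊛ y) (⊛-comm l y) ⟩
    (y ⊛ l) ⊛ (l ⊛ y) ⊕ y ⊛ y                           ≡⟨ cong (_⊕ y ⊛ y) (⊛-assoc y l (l ⊛ y)) ⟩
    y ⊛ (l ⊛ (l ⊛ y)) ⊕ y ⊛ y                           ≡⟨ cong (λ w → y ⊛ w ⊕ y ⊛ y) (⊛-assoc l l y) ⟨
    y ⊛ ((l ⊛ l) ⊛ y) ⊕ y ⊛ y                           ≡⟨ cong (λ w → y ⊛ (w ⊛ y) ⊕ y ⊛ y) l² ⟩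
    y ⊛ (⊝ 𝟙 ⊛ y) ⊕ y ⊛ y                               ≡⟨ cong (λ w → y ⊛ w ⊕ y ⊛ y) (-1*x≈-x y) ⟩
    y ⊛ ⊝ y ⊕ y ⊛ y                                     ≡⟨ ⊛-distribˡ-⊕ y (⊝ y) y ⟨
    y ⊛ (⊝ y ⊕ y)                                       ≡⟨ cong (y ⊛_) (-‿inverseˡ y) ⟩
    y ⊛ 𝟘                                               ≡⟨ ⊛-zeroʳ y ⟩
    𝟘                                                   ∎)
    where
    open ≡-Reasoning
    x = fromℤ m
    y = fromℤ n

  -- As 1600 = 40², the prime p divides 40. Among the divisors of 40 only 1 and 5 are congruent to 1
  -- modulo 4, which is checked by a table, and primality excludes 1.
  p∣1600⇒p≡5 : p ∣ 1600 → p ≡ 5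
  p∣1600⇒p≡5 d = small (toWitness {a? = all? λ k → small? (toℕ k)} _) p≤40 p∣40
    where
    p∣40 : p ∣ 40
    p∣40 = [ id , id ]′ (euclidsLemma 40 40 pr d)
    p≤40 : p < 41
    p≤40 = s≤s (∣⇒≤ p∣40)
    Small : ℕ → Set
    Small k = k ∣ 40 → k % 4 ≡ 1 → k ≡ 1 ⊎ k ≡ 5
    small? : ∀ k → Dec (Small k)
    small? k = k ∣? 40 →-dec ((k % 4) ℕ.≟ 1 →-dec (k ℕ.≟ 1 ⊎-dec k ℕ.≟ 5))
    small : (∀ (k : Fin 41) → Small (toℕ k)) → p < 41 → p ∣ 40 → p ≡ 5
    small f p< d' with subst Small (Fin.toℕ-fromℕ< p<) (f (fromℕ< p<)) d' p≡1
    ... | inj₁ e    = ⊥-elim (¬prime[1] (subst Prime e pr))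
    ... | inj₂ e    = e

obstruction-exists : ∀ p .{{_ : NonZero p}} → Prime p → p % 4 ≡ 1 → ∀ l →
  Residues._⊛_ p l l ≡ Residues.⊝_ p (Residues.𝟙 p) → Obstruction (Residues.Vanishes p l)
obstruction-exists p pr p≡1 l l² with p ℕ.≟ 5
... | yes refl = obstruction-5 l l²
... | no p≢5   = genericObstruction zero-vanishes
      λ {m} {n} z d → p≢5 (p∣1600⇒p≡5 p pr p≡1 (∣-trans (vanishes⇒∣norm p pr p≡1 l l² m n z) d))
  where
  open Field p pr p≡1
  zero-vanishes : Vanishes l 0ℤ 0ℤ
  zero-vanishes = trans (⊕-identityˡ (l ⊛ 𝟘)) (⊛-zeroʳ l)

-- Iterating a map with trivial fourth power; sides and directions under such iteration.

module _ {A : Set} (f : A → A) (f⁴≡id : ∀ x → f (f (f (f x))) ≡ x) where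

  fold-*4 : ∀ q x → fold x f (q * 4) ≡ x
  fold-*4 zero    x = refl
  fold-*4 (suc q) x = trans (f⁴≡id (fold x f (q * 4))) (fold-*4 q x)

  -- Reducing i + j modulo 4 drops a multiple of four applications. Iteration thus becomes an action
  -- of ℤ₄, both for `δ` on vertices and for `α` on H.
  fold-+₄ : ∀ i j x → fold x f (toℕ (_+ₙ_ 4 i j)) ≡ fold (fold x f (toℕ j)) f (toℕ i)
  fold-+₄ i j x = begin
    fold x f (toℕ (_+ₙ_ 4 i j))              ≡⟨ cong (fold x f) (Residues.toℕ-modN 4 n) ⟩
    fold x f (n % 4)                         ≡⟨ cong (λ y → fold y f (n % 4)) (fold-*4 (n / 4) x) ⟨
    fold (fold x f (n / 4 * 4)) f (n % 4)    ≡⟨ fold-+ x f (n % 4) ⟨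
    fold x f (n % 4 + n / 4 * 4)             ≡⟨ cong (fold x f) (m≡m%n+[m/n]*n n 4) ⟨
    fold x f n                               ≡⟨ fold-+ x f (toℕ i) ⟩
    fold (fold x f (toℕ j)) f (toℕ i)        ∎
    where
    open ≡-Reasoning
    n = toℕ i + toℕ j

-- The effect of `δ` on directions: a c goes to b c^λ, which keeps the sign, while b c^λ goes to a
-- c^(λ²) = a c⁻¹, which reverses it.
turn : Fin 2 → Sign → Sign
turn f0      ε = ε
turn (fs f0) ε = opposite ε

-- The side and the direction of the image of the arc from `v₀` along `N pos` under the n-th power
-- of `δ`. The four powers realise all four combinations.
frame : ℕ → Fin 2 × Sign
frame zero    = f0 , pos
frame (suc n) = let i , ε = frame n in other i , turn i ε

index : Fin 2 × Sign → Fin 4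
index (f0    , pos) = f0
index (fs f0 , pos) = fs f0
index (f0    , neg) = fs (fs f0)
index (fs f0 , neg) = fs (fs (fs f0))

frame-index : ∀ c → frame (toℕ (index c)) ≡ c
frame-index (f0    , pos) = refl
frame-index (fs f0 , pos) = refl
frame-index (f0    , neg) = refl
frame-index (fs f0 , neg) = refl

index-frame : ∀ i → index (frame (toℕ i)) ≡ i
index-frame f0                = refl
index-frame (fs f0)           = refl
index-frame (fs (fs f0))      = refl
index-frame (fs (fs (fs f0))) = refl

-- The groups S₃ and H, and the steps of the graph.

S3-group : Group 0ℓ 0ℓ
S3-group = record
  { Carrier = S3 ; _≈_ = _≡_ ; _∙_ = _·S_ ; ε = eS ; _⁻¹ = invS
  ; isGroup = record
    { isMonoid = record
      { isSemigroup = record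
        { isMagma = record { isEquivalence = isEquivalence ; ∙-cong = cong₂ _·S_ }
        ; assoc = ·S-assoc }
      ; identity = ·S-identityˡ , ·S-identityʳ }
    ; inverse = ·S-inverseˡ , ·S-inverseʳ
    ; ⁻¹-cong = cong invS } }

module S3Props = Algebra.Properties.Group S3-group

module Graph (p : ℕ) .{{_ : NonZero p}} (pr : Prime p) (p≡1 : p % 4 ≡ 1) (λ' : ℕ)
             (l² : Residues._⊛_ p (modN p λ') (modN p λ') ≡ Residues.⊝_ p (Residues.𝟙 p)) where

  open Field p pr p≡1

  l : Fin p
  l = modN p λ'

  V : Set
  V = proj₁ (NC9-12p p λ')

  Adj : V → V → Set
  Adj = proj₂ (NC9-12p p λ')

  open GraphNotions V Adj public

  H : Set
  H = Hgrp p

  infixl 7 _·_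
  _·_ : H → H → H
  _·_ = _·H_ p

  e : H
  e = eH p

  H-group : Group 0ℓ 0ℓ
  H-group = record
    { Carrier = H ; _≈_ = _≡_ ; _∙_ = _·_ ; ε = e ; _⁻¹ = invH p
    ; isGroup = record
      { isMonoid = record
        { isSemigroup = record
          { isMagma = record { isEquivalence = isEquivalence ; ∙-cong = cong₂ _·_ }
          ; assoc = λ (r , x) (s , y) (t , z) → cong₂ _,_ (·S-assoc r s t) (⊕-assoc x y z) }
        ; identity = (λ (s , x) → cong₂ _,_ (·S-identityˡ s) (⊕-identityˡ x))
                   , (λ (s , x) → cong₂ _,_ (·S-identityʳ s) (⊕-identityʳ x)) }
      ; inverse = (λ (s , x) → cong₂ _,_ (·S-inverseˡ s) (-‿inverseˡ x))
                , (λ (s , x) → cong₂ _,_ (·S-inverseʳ s) (⊝-inverseʳ x))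
      ; ⁻¹-cong = cong (invH p) } }

  open Group H-group using () renaming
    ( assoc to ·-assoc; identityˡ to ·-identityˡ; identityʳ to ·-identityʳ
    ; _⁻¹ to inv; inverseʳ to ·-inverseʳ; inverseˡ to ·-inverseˡ )
  module HP = Algebra.Properties.Group H-group

  genX : Fin 2 → Fin p
  genX f0      = 𝟙
  genX (fs f0) = l

  gen : Fin 2 → Sign → H
  gen i ε = genS i , signed ε (genX i)

  -- Adjacency is a condition on g h⁻¹, so steps multiply on the left and commute with right
  -- translations.
  act : Step → V → V
  act S     (i , h) = other i , h
  act (N ε) (i , h) = i , gen i ε · h

  acts : List Step → V → V
  acts []      v = v
  acts (t ∷ w) v = acts w (act t v)

  genX-inverse : Fin 2 → Fin p
  genX-inverse f0      = 𝟙
  genX-inverse (fs f0) = ⊝ l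

  genX-invertible : ∀ i → genX-inverse i ⊛ genX i ≡ 𝟙
  genX-invertible f0      = ⊛-identityˡ 𝟙
  genX-invertible (fs f0) =
    trans (sym (-‿distribˡ-* l l)) (trans (cong ⊝_ l²) (⊝-involutive 𝟙))

  genX≢𝟘 : ∀ i → genX i ≢ 𝟘
  genX≢𝟘 i eq = 𝟙≢𝟘 (trans (sym (genX-invertible i))
    (trans (cong (genX-inverse i ⊛_) eq) (⊛-zeroʳ (genX-inverse i))))

  genS-involutive : ∀ i s → genS i ·S (genS i ·S s) ≡ s
  genS-involutive f0      s = trans (sym (·S-assoc aS aS s)) (·S-identityˡ s)
  genS-involutive (fs f0) s = trans (sym (·S-assoc bS bS s)) (·S-identityˡ s)

  other≢ : ∀ (i : Fin 2) → other i ≢ i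
  other≢ f0 ()
  other≢ (fs f0) ()

  act-reverse : ∀ t v → act (reverse t) (act t v) ≡ v
  act-reverse S     (i , h)     = cong (_, h) (Fin.opposite-involutive i)
  act-reverse (N ε) (i , s , x) = cong (i ,_) (cong₂ _,_ (genS-involutive i s) (begin
    signed (opposite ε) (genX i) ⊕ (signed ε (genX i) ⊕ x)  ≡⟨ ⊕-assoc _ _ x ⟨
    signed (opposite ε) (genX i) ⊕ signed ε (genX i) ⊕ x    ≡⟨ cong (_⊕ x) (⊕-comm _ (signed ε (genX i))) ⟩
    signed ε (genX i) ⊕ signed (opposite ε) (genX i) ⊕ x    ≡⟨ cong (_⊕ x) (signed-opposite ε (genX i)) ⟩
    𝟘 ⊕ x                                                   ≡⟨ ⊕-identityˡ x ⟩
    x                                                       ∎))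
    where open ≡-Reasoning

  act-reverse′ : ∀ t v → act t (act (reverse t) v) ≡ v
  act-reverse′ t v = trans (cong (λ u → act u (act (reverse t) v)) (sym (reverse-involutive t)))
                           (act-reverse (reverse t) v)

  -- The two cycle neighbours differ because p is odd. Hence each edge at a vertex has exactly one
  -- step, and automorphisms can be read as maps on steps.
  act-injective : ∀ t u v → act t v ≡ act u v → t ≡ u
  act-injective S     S      v       eq = refl
  act-injective S     (N ε)  (i , h) eq = ⊥-elim (other≢ i (cong proj₁ eq))
  act-injective (N ε) S      (i , h) eq = ⊥-elim (other≢ i (sym (cong proj₁ eq)))
  act-injective (N ε) (N ε′) (i , s , x) eq = cong N (signed-injective ε ε′ (genX≢𝟘 i)
    (⊕-cancelʳ x (signed ε (genX i)) (signed ε′ (genX i)) (cong (proj₂ ∘ proj₂) eq)))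

  adj-act : ∀ t v → Adj v (act t v)
  adj-act S       (f0 , h)    = ·-inverseʳ h
  adj-act S       (fs f0 , h) = ·-inverseʳ h
  adj-act (N pos) (f0 , h)    = inj₁ (HP.//-rightDividesʳ h (gen f0 pos))
  adj-act (N neg) (f0 , h)    = inj₂ (HP.//-rightDividesʳ h (gen f0 neg))
  adj-act (N pos) (fs f0 , h) = inj₁ (HP.//-rightDividesʳ h (gen (fs f0) pos))
  adj-act (N neg) (fs f0 , h) = inj₂ (HP.//-rightDividesʳ h (gen (fs f0) neg))

  solve-right : ∀ k h g → g · inv h ≡ k → k · h ≡ g
  solve-right k h g refl = HP.//-rightDividesˡ h g

  adj⇒act : ∀ u v → Adj u v → ∃ λ t → act t u ≡ v
  adj⇒act (f0 , h)    (f0 , g)    (inj₁ eq) = N pos , cong (f0 ,_) (solve-right (gen f0 pos) h g eq)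
  adj⇒act (f0 , h)    (f0 , g)    (inj₂ eq) = N neg , cong (f0 ,_) (solve-right (gen f0 neg) h g eq)
  adj⇒act (f0 , h)    (fs f0 , g) eq        = S , cong (fs f0 ,_) (sym (HP.x∙y⁻¹≈ε⇒x≈y g h eq))
  adj⇒act (fs f0 , h) (f0 , g)    eq        = S , cong (f0 ,_) (HP.x∙y⁻¹≈ε⇒x≈y h g eq)
  adj⇒act (fs f0 , h) (fs f0 , g) (inj₁ eq) = N pos , cong (fs f0 ,_) (solve-right (gen (fs f0) pos) h g eq)
  adj⇒act (fs f0 , h) (fs f0 , g) (inj₂ eq) = N neg , cong (fs f0 ,_) (solve-right (gen (fs f0) neg) h g eq)

  -- Valency, order and connectedness.

  cubic : Cubic
  cubic u = neighbour , (λ i → adj-act (step i) u) , complete , injective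
    where
    step : Fin 3 → Step
    step f0           = S
    step (fs f0)      = N pos
    step (fs (fs f0)) = N neg
    number : Step → Fin 3
    number S       = f0
    number (N pos) = fs f0
    number (N neg) = fs (fs f0)
    step-number : ∀ t → step (number t) ≡ t
    step-number S       = refl
    step-number (N pos) = refl
    step-number (N neg) = refl
    number-step : ∀ i → number (step i) ≡ i
    number-step f0           = refl
    number-step (fs f0)      = refl
    number-step (fs (fs f0)) = refl
    neighbour : Fin 3 → V
    neighbour i = act (step i) u
    complete : ∀ v → Adj u v → ∃ λ i → neighbour i ≡ v
    complete v a with adj⇒act u v a
    ... | t , eq = number t , trans (cong (λ t′ → act t′ u) (step-number t)) eq
    injective : ∀ i j → neighbour i ≡ neighbour j → i ≡ j
    injective i j eq = trans (sym (number-step i))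
      (trans (cong number (act-injective (step i) (step j) u eq)) (number-step j))

  hasOrder : HasOrder (12 * p)
  hasOrder = subst (λ n → V ↔ Fin n) (sym (ℕ.*-assoc 2 6 p))
    (↔-sym (Fin.*↔× {2} {6 * p}) ↔-∘ (↔-id (Fin 2) ×-↔
      (↔-sym (Fin.*↔× {6} {p}) ↔-∘ (↔-sym (Fin.*↔× {3} {2}) ×-↔ ↔-id (Fin p)))))

  -- Two cycle steps restore the S₃ coordinate and add 2 `genX i`, an invertible element of ℤₚ, so
  -- its multiples reach every `y`.
  column : ∀ (P : V → Set) i → (∀ h → P (i , h) → P (act (N pos) (i , h))) →
           ∀ {s x} y → P (i , s , x) → P (i , s , y)
  column P i closed {s} {x} y px =
    subst (λ z → P (i , s , z)) eq (multiple (toℕ k))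
    where
    open ≡-Reasoning
    u = genX i
    d = y ⊕ ⊝ x
    -- The number of double steps: the solution of k (u + u) = y - x.
    k = ½ ⊛ (d ⊛ genX-inverse i)

    double : ∀ {z} → P (i , s , z) → P (i , s , (u ⊕ u) ⊕ z)
    double {z} pz = subst (λ w → P (i , w))
      (cong₂ _,_ (genS-involutive i s) (sym (⊕-assoc u u z)))
      (closed _ (closed _ pz))

    multiple : ∀ n → P (i , s , modN p n ⊛ (u ⊕ u) ⊕ x)
    multiple zero    = subst (λ z → P (i , s , z))
      (sym (trans (cong (_⊕ x) (⊛-zeroˡ (u ⊕ u))) (⊕-identityˡ x))) px
    multiple (suc n) = subst (λ z → P (i , s , z)) (begin
      (u ⊕ u) ⊕ (m ⊛ (u ⊕ u) ⊕ x)         ≡⟨ ⊕-assoc (u ⊕ u) (m ⊛ (u ⊕ u)) x ⟨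
      (u ⊕ u) ⊕ m ⊛ (u ⊕ u) ⊕ x           ≡⟨ cong (λ z → z ⊕ m ⊛ (u ⊕ u) ⊕ x) (⊛-identityˡ (u ⊕ u)) ⟨
      𝟙 ⊛ (u ⊕ u) ⊕ m ⊛ (u ⊕ u) ⊕ x       ≡⟨ cong (_⊕ x) (⊛-distribʳ-⊕ (u ⊕ u) 𝟙 m) ⟨
      (𝟙 ⊕ m) ⊛ (u ⊕ u) ⊕ x               ≡⟨ cong (λ z → z ⊛ (u ⊕ u) ⊕ x) (modN-+ 1 n) ⟨
      modN p (suc n) ⊛ (u ⊕ u) ⊕ x        ∎) (double (multiple n))
      where m = modN p n

    eq : modN p (toℕ k) ⊛ (u ⊕ u) ⊕ x ≡ y
    eq = begin
      modN p (toℕ k) ⊛ (u ⊕ u) ⊕ x        ≡⟨ cong (λ z → z ⊛ (u ⊕ u) ⊕ x) (modN-toℕ k) ⟩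
      k ⊛ (u ⊕ u) ⊕ x                     ≡⟨ cong (_⊕ x) (⊛-distribˡ-⊕ k u u) ⟩
      k ⊛ u ⊕ k ⊛ u ⊕ x                   ≡⟨ cong (λ z → z ⊕ z ⊕ x) ku ⟩
      ½ ⊛ d ⊕ ½ ⊛ d ⊕ x                   ≡⟨ cong (_⊕ x) (⊛-distribʳ-⊕ d ½ ½) ⟨
      (½ ⊕ ½) ⊛ d ⊕ x                     ≡⟨ cong (λ z → z ⊛ d ⊕ x) ½⊕½≡𝟙 ⟩
      𝟙 ⊛ d ⊕ x                           ≡⟨ cong (_⊕ x) (⊛-identityˡ d) ⟩
      y ⊕ ⊝ x ⊕ x                         ≡⟨ [x⊕⊝y]⊕y≡x x y ⟩
      y                                   ∎
      where
      ku : k ⊛ u ≡ ½ ⊛ d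
      ku = begin
        ½ ⊛ (d ⊛ genX-inverse i) ⊛ u      ≡⟨ ⊛-assoc ½ (d ⊛ genX-inverse i) u ⟩
        ½ ⊛ (d ⊛ genX-inverse i ⊛ u)      ≡⟨ cong (½ ⊛_) (⊛-assoc d (genX-inverse i) u) ⟩
        ½ ⊛ (d ⊛ (genX-inverse i ⊛ u))    ≡⟨ cong (λ z → ½ ⊛ (d ⊛ z)) (genX-invertible i) ⟩
        ½ ⊛ (d ⊛ 𝟙)                       ≡⟨ cong (½ ⊛_) (⊛-identityʳ d) ⟩
        ½ ⊛ d                             ∎

  -- Connectedness as an induction principle, used for walks and again for fixed stars. A word in a
  -- and b for the S₃ displacement is followed letter by letter: change to the side of the letter,
  -- step, and then repair the ℤₚ coordinate with `column`.
  reach : ∀ (P : V → Set) → (∀ t v → P v → P (act t v)) → ∀ u v → P u → P v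
  reach P closed (i , s , x) (j , t , y) pu =
    subst (λ r → P (j , r , y)) (trans (cong (_·S s) w≡) (S3Props.//-rightDividesˡ s t))
      (word (proj₁ (S3-generated (t ·S invS s))) j y)
    where
    w≡ = proj₂ (S3-generated (t ·S invS s))

    switch : ∀ i j {h} → P (i , h) → P (j , h)
    switch f0      f0      q = q
    switch f0      (fs f0) q = closed S _ q
    switch (fs f0) f0      q = closed S _ q
    switch (fs f0) (fs f0) q = q

    word : ∀ w j y → P (j , foldr (λ k r → genS k ·S r) eS w ·S s , y)
    word []      j y = switch i j (column P i (λ _ → closed (N pos) _) y
      (subst (λ r → P (i , r , x)) (sym (·S-identityˡ s)) pu))
    -- The recursive call may leave any ℤₚ coordinate, here `x`, since `column` then moves it to
    -- `y`.
    word (k ∷ w) j y = switch k j (column P k (λ _ → closed (N pos) _) y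
      (subst (λ r → P (k , r , signed pos (genX k) ⊕ x)) (sym (·S-assoc (genS k) _ s))
        (closed (N pos) _ (word w k x))))

  connected : Connected
  connected u v = reach (Walk u) (λ t w walk → snoc walk (adj-act t w)) u v []
    where
    snoc : ∀ {u v w} → Walk u v → Adj v w → Walk u w
    snoc []      b = b ∷ []
    snoc (a ∷ q) b = a ∷ snoc q b

  -- Evaluating states and words at vertices.

  ⟦_⟧ : State → H → V
  ⟦ i , d , m , n ⟧ (s , x) = i , d ·S s , (fromℤ m ⊕ l ⊛ fromℤ n) ⊕ x

  act-⟦⟧ : ∀ t st h → act t (⟦ st ⟧ h) ≡ ⟦ move t st ⟧ h
  act-⟦⟧ S     st                    h       = refl
  act-⟦⟧ (N ε) (f0 , d , m , n)      (s , x) =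
    cong (f0 ,_) (cong₂ _,_ (sym (·S-assoc aS d s)) (begin
      signed ε 𝟙 ⊕ ((fromℤ m ⊕ y) ⊕ x)      ≡⟨ ⊕-assoc (signed ε 𝟙) (fromℤ m ⊕ y) x ⟨
      (signed ε 𝟙 ⊕ (fromℤ m ⊕ y)) ⊕ x      ≡⟨ cong (_⊕ x) (⊕-assoc (signed ε 𝟙) (fromℤ m) y) ⟨
      ((signed ε 𝟙 ⊕ fromℤ m) ⊕ y) ⊕ x      ≡⟨ cong (λ z → (z ⊕ y) ⊕ x) (fromℤ-shift ε m) ⟨
      (fromℤ (shift ε m) ⊕ y) ⊕ x           ∎))
    where
    open ≡-Reasoning
    y = l ⊛ fromℤ n
  act-⟦⟧ (N ε) (fs f0 , d , m , n)   (s , x) =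
    cong (fs f0 ,_) (cong₂ _,_ (sym (·S-assoc bS d s)) (begin
      signed ε l ⊕ ((y ⊕ z) ⊕ x)                   ≡⟨ ⊕-assoc (signed ε l) (y ⊕ z) x ⟨
      (signed ε l ⊕ (y ⊕ z)) ⊕ x                   ≡⟨ cong (λ w → (signed ε l ⊕ w) ⊕ x) (⊕-comm y z) ⟩
      (signed ε l ⊕ (z ⊕ y)) ⊕ x                   ≡⟨ cong (_⊕ x) (⊕-assoc (signed ε l) z y) ⟨
      ((signed ε l ⊕ z) ⊕ y) ⊕ x                   ≡⟨ cong (λ w → ((signed ε w ⊕ z) ⊕ y) ⊕ x) (⊛-identityʳ l) ⟨
      ((signed ε (l ⊛ 𝟙) ⊕ z) ⊕ y) ⊕ x             ≡⟨ cong (λ w → ((w ⊕ z) ⊕ y) ⊕ x) (⊛-signed ε l 𝟙) ⟨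
      ((l ⊛ signed ε 𝟙 ⊕ z) ⊕ y) ⊕ x               ≡⟨ cong (λ w → (w ⊕ y) ⊕ x) (⊛-distribˡ-⊕ l (signed ε 𝟙) (fromℤ n)) ⟨
      (l ⊛ (signed ε 𝟙 ⊕ fromℤ n) ⊕ y) ⊕ x         ≡⟨ cong (λ w → (l ⊛ w ⊕ y) ⊕ x) (fromℤ-shift ε n) ⟨
      (l ⊛ fromℤ (shift ε n) ⊕ y) ⊕ x              ≡⟨ cong (_⊕ x) (⊕-comm _ y) ⟩
      (y ⊕ l ⊛ fromℤ (shift ε n)) ⊕ x              ∎))
    where
    open ≡-Reasoning
    y = fromℤ m
    z = l ⊛ fromℤ n

  acts-⟦⟧ : ∀ w st h → acts w (⟦ st ⟧ h) ≡ ⟦ moves w st ⟧ h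
  acts-⟦⟧ []      st h = refl
  acts-⟦⟧ (t ∷ w) st h = trans (cong (acts w) (act-⟦⟧ t st h)) (acts-⟦⟧ w (move t st) h)

  ⟦start⟧ : ∀ i h → ⟦ start i ⟧ h ≡ (i , h)
  ⟦start⟧ i (s , x) = cong (i ,_) (cong₂ _,_ (·S-identityˡ s) (begin
    (𝟘 ⊕ l ⊛ 𝟘) ⊕ x   ≡⟨ cong (λ z → (𝟘 ⊕ z) ⊕ x) (⊛-zeroʳ l) ⟩
    (𝟘 ⊕ 𝟘) ⊕ x       ≡⟨ cong (_⊕ x) (⊕-identityˡ 𝟘) ⟩
    𝟘 ⊕ x             ≡⟨ ⊕-identityˡ x ⟩
    x                 ∎))
    where open ≡-Reasoning

  acts-start : ∀ w i h → acts w (i , h) ≡ ⟦ moves w (start i) ⟧ h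
  acts-start w i h = trans (cong (acts w) (sym (⟦start⟧ i h))) (acts-⟦⟧ w (start i) h)

  -- The displacement of a word depends on the starting side and not on `h`. With the converse
  -- below, closed walks become a matter of states alone.
  closed⇒fixes : ∀ w i h → Closed (Vanishes l) i (moves w (start i)) → acts w (i , h) ≡ (i , h)
  closed⇒fixes w i h c = trans (acts-start w i h) (interpret (moves w (start i)) h c)
    where
    interpret : ∀ st h → Closed (Vanishes l) i st → ⟦ st ⟧ h ≡ (i , h)
    interpret st (s , x) (refl , refl , z) =
      cong (i ,_) (cong₂ _,_ (·S-identityˡ s) (trans (cong (_⊕ x) z) (⊕-identityˡ x)))

  fixes⇒closed : ∀ w i h → acts w (i , h) ≡ (i , h) → Closed (Vanishes l) i (moves w (start i))
  fixes⇒closed w i h eq = interpret (moves w (start i)) h (trans (sym (acts-start w i h)) eq)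
    where
    interpret : ∀ st h → ⟦ st ⟧ h ≡ (i , h) → Closed (Vanishes l) i st
    interpret (j , d , m , n) (s , x) eq =
      cong proj₁ eq ,
      S3Props.identityˡ-unique d s (cong (proj₁ ∘ proj₂) eq) ,
      ⊕-identityˡ-unique (fromℤ m ⊕ l ⊛ fromℤ n) x (cong (proj₂ ∘ proj₂) eq)

  -- Automorphisms preserve the spokes

  to-injective : ∀ f {u v} → to f u ≡ to f v → u ≡ v
  to-injective f {u} {v} eq = trans (sym (Inverse.strictlyInverseʳ (perm f) u))
    (trans (cong (from f) eq) (Inverse.strictlyInverseʳ (perm f) v))

  mkAut : (f g : V → V) → (∀ v → f (g v) ≡ v) → (∀ v → g (f v) ≡ v) →
          (∀ u v → Adj u v → Adj (f u) (f v)) → (∀ u v → Adj u v → Adj (g u) (g v)) → Automorphism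
  mkAut f g fg gf fp gp = record
    { perm   = mk↔ₛ′ f g fg gf
    ; pres   = fp
    ; reflec = λ u v a → subst₂ Adj (gf u) (gf v) (gp (f u) (f v) a)
    }

  _⁻¹A : Automorphism → Automorphism
  f ⁻¹A = mkAut (from f) (to f) (Inverse.strictlyInverseʳ (perm f)) (Inverse.strictlyInverseˡ (perm f))
    (λ u v a → reflec f (from f u) (from f v)
      (subst₂ Adj (sym (Inverse.strictlyInverseˡ (perm f) u)) (sym (Inverse.strictlyInverseˡ (perm f) v)) a))
    (pres f)

  image : Automorphism → V → Step → Step
  image f v t = proj₁ (adj⇒act (to f v) (to f (act t v)) (pres f v (act t v) (adj-act t v)))

  act-image : ∀ f v t → act (image f v t) (to f v) ≡ to f (act t v)
  act-image f v t = proj₂ (adj⇒act (to f v) (to f (act t v)) (pres f v (act t v) (adj-act t v)))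

  image-unique : ∀ f v t u → act u (to f v) ≡ to f (act t v) → image f v t ≡ u
  image-unique f v t u eq = act-injective (image f v t) u (to f v) (trans (act-image f v t) (sym eq))

  -- If the image walk turned back, injectivity of `f` would make the original walk turn back.
  image-reduced : ∀ f v t u → u ≢ reverse t → image f (act t v) u ≢ reverse (image f v t)
  image-reduced f v t u u≢ eq = u≢ (act-injective u (reverse t) (act t v)
    (trans (to-injective f (begin
      to f (act u (act t v))                                    ≡⟨ act-image f (act t v) u ⟨
      act (image f (act t v) u) (to f (act t v))                ≡⟨ cong₂ act eq (sym (act-image f v t)) ⟩
      act (reverse (image f v t)) (act (image f v t) (to f v))  ≡⟨ act-reverse (image f v t) (to f v) ⟩
      to f v                                                    ∎)) (sym (act-reverse t v))))
    where open ≡-Reasoning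

  images : Automorphism → V → List Step → List Step
  images f v []      = []
  images f v (t ∷ w) = image f v t ∷ images f (act t v) w

  images-length : ∀ f v w → length (images f v w) ≡ length w
  images-length f v []      = refl
  images-length f v (t ∷ w) = cong suc (images-length f (act t v) w)

  acts-images : ∀ f v w → acts (images f v w) (to f v) ≡ to f (acts w v)
  acts-images f v []      = refl
  acts-images f v (t ∷ w) = trans (cong (acts (images f (act t v) w)) (act-image f v t))
                                  (acts-images f (act t v) w)

  images-reduced : ∀ f v t w → Reduced t w → Reduced (image f v t) (images f (act t v) w)
  images-reduced f v t []      []      = []
  images-reduced f v t (u ∷ w) (u≢ ∷ r) =
    image-reduced f v t u u≢ ∷ images-reduced f (act t v) u w r

  module _ (obs : Obstruction (Vanishes l)) where
    open Obstruction obs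

    ≢S⇒N : ∀ t → t ≢ S → ∃ λ ε → t ≡ N ε
    ≢S⇒N S     t≢S = ⊥-elim (t≢S refl)
    ≢S⇒N (N ε) _   = ε , refl

    -- Otherwise the reduced walk `flank ε`, `N ε`, `flank ε` around the edge is mapped to some N S
    -- N, which `closable` completes to a closed walk. The inverse of `f` carries the completion
    -- back with the same length and still reduced, against `notClosable`.
    N↛S : ∀ f v ε → to f (act (N ε) v) ≢ act S (to f v)
    N↛S f v ε eq = notClosable (proj₁ v₀) ε w′ (trans (images-length g u₃ w) len-w) reduced
      (fixes⇒closed (flank ε ∷ N ε ∷ flank ε ∷ w′) (proj₁ v₀) (proj₂ v₀) closed)
      where
      open ≡-Reasoning
      g = f ⁻¹A
      v₀ = act (reverse (flank ε)) v
      v₀→v : act (flank ε) v₀ ≡ v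
      v₀→v = act-reverse′ (flank ε) v
      v₂ = act (N ε) v
      v₃ = act (flank ε) v₂
      u₀ = to f v₀
      u₂ = to f v₂
      u₃ = to f v₃
      middle : image f (act (flank ε) v₀) (N ε) ≡ S
      middle = trans (cong (λ x → image f x (N ε)) v₀→v) (image-unique f v (N ε) S (sym eq))
      -- A spoke is its own reverse, so in a reduced walk the edges next to the spoke `middle` are
      -- cycle edges.
      first = ≢S⇒N (image f v₀ (flank ε)) λ e₁ →
        image-reduced f v₀ (flank ε) (N ε) (flank-N ε) (trans middle (sym (cong reverse e₁)))
      ε₁ = proj₁ first
      last = ≢S⇒N (image f v₂ (flank ε)) λ e₂ →
        image-reduced f v (N ε) (flank ε) (N-flank ε)
          (trans e₂ (cong reverse (sym (image-unique f v (N ε) S (sym eq)))))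
      ε₂ = proj₁ last
      step₁ : act (N ε₁) u₀ ≡ to f v
      step₁ = trans (cong (λ t → act t u₀) (sym (proj₂ first)))
                (trans (act-image f v₀ (flank ε)) (cong (to f) v₀→v))
      step₃ : act (N ε₂) u₂ ≡ u₃
      step₃ = trans (cong (λ t → act t u₂) (sym (proj₂ last))) (act-image f v₂ (flank ε))
      closing = closable (proj₁ u₀) ε₁ ε₂
      w = proj₁ closing
      len-w = proj₁ (proj₂ closing)
      w-closed : acts w u₃ ≡ u₀
      w-closed = begin
        acts w u₃                                  ≡⟨ cong (acts w) step₃ ⟨
        acts (N ε₂ ∷ w) u₂                         ≡⟨ cong (acts (N ε₂ ∷ w)) eq ⟩
        acts (S ∷ N ε₂ ∷ w) (to f v)               ≡⟨ cong (acts (S ∷ N ε₂ ∷ w)) step₁ ⟨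
        acts (N ε₁ ∷ S ∷ N ε₂ ∷ w) u₀              ≡⟨ closed⇒fixes (N ε₁ ∷ S ∷ N ε₂ ∷ w) (proj₁ u₀) (proj₂ u₀)
                                                        (proj₂ (proj₂ (proj₂ closing))) ⟩
        u₀                                         ∎
      g∘f : ∀ x → to g (to f x) ≡ x
      g∘f = Inverse.strictlyInverseʳ (perm f)
      w′ = images g u₃ w
      -- Identifies the step that precedes `w′` in the pulled-back walk, as reducedness of `w′` is
      -- relative to it.
      back : image g u₂ (N ε₂) ≡ flank ε
      back = image-unique g u₂ (N ε₂) (flank ε) (begin
        act (flank ε) (to g u₂)    ≡⟨ cong (act (flank ε)) (g∘f v₂) ⟩
        v₃                         ≡⟨ g∘f v₃ ⟨
        to g u₃                    ≡⟨ cong (to g) step₃ ⟨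
        to g (act (N ε₂) u₂)       ∎)
      reduced : Reduced (flank ε) w′
      reduced = subst₂ (λ t x → Reduced t (images g x w)) back step₃
        (images-reduced g u₂ (N ε₂) w (proj₁ (proj₂ (proj₂ closing))))
      closed : acts (flank ε ∷ N ε ∷ flank ε ∷ w′) v₀ ≡ v₀
      closed = begin
        acts (N ε ∷ flank ε ∷ w′) (act (flank ε) v₀)  ≡⟨ cong (acts (N ε ∷ flank ε ∷ w′)) v₀→v ⟩
        acts w′ v₃                                    ≡⟨ cong (acts w′) (g∘f v₃) ⟨
        acts w′ (to g u₃)                             ≡⟨ acts-images g u₃ w ⟩
        to g (acts w u₃)                              ≡⟨ cong (to g) w-closed ⟩
        to g u₀                                       ≡⟨ g∘f v₀ ⟩
        v₀                                            ∎

    image-N : ∀ f v ε → ∃ λ ε′ → act (N ε′) (to f v) ≡ to f (act (N ε) v)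
    image-N f v ε with image f v (N ε) | act-image f v (N ε)
    ... | S    | eq = ⊥-elim (N↛S f v ε (sym eq))
    ... | N ε′ | eq = ε′ , eq

    -- A spoke mapped to a cycle edge would make the inverse of `f` map a cycle edge to a spoke.
    image-S : ∀ f v → act S (to f v) ≡ to f (act S v)
    image-S f v with image f v S | act-image f v S
    ... | S    | eq = eq
    ... | N ε′ | eq = ⊥-elim (N↛S (f ⁻¹A) (to f v) ε′ (begin
        from f (act (N ε′) (to f v))   ≡⟨ cong (from f) eq ⟩
        from f (to f (act S v))        ≡⟨ g∘f (act S v) ⟩
        act S v                        ≡⟨ cong (act S) (g∘f v) ⟨
        act S (from f (to f v))        ∎))
      where
      open ≡-Reasoning
      g∘f = Inverse.strictlyInverseʳ (perm f)

    -- Rigidity: an automorphism fixing both ends of a cycle edge.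

    module Rigid (f : Automorphism) where

      FixesStar : V → Set
      FixesStar v = to f v ≡ v × (∀ t → to f (act t v) ≡ act t v)

      -- Spokes go to spokes, so the far end of the spoke is fixed. The two cycle neighbours are
      -- permuted among themselves, and one being fixed forces the other.
      fixesStar : ∀ v ε → to f v ≡ v → to f (act (N ε) v) ≡ act (N ε) v → FixesStar v
      fixesStar v ε fv fεv = fv , λ where
          S      → trans (sym (image-S f v)) (cong (act S) fv)
          (N ε′) → along ε′
        where
        along : ∀ ε′ → to f (act (N ε′) v) ≡ act (N ε′) v
        along ε′ with image-N f v ε′
        ... | ε₁ , eq with trans (sym eq) (cong (act (N ε₁)) fv) | ε Sign.≟ ε′ | ε Sign.≟ ε₁
        ... | _   | yes refl | _        = fεv
        ... | eq′ | no ε≢ε′  | yes refl =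
          ⊥-elim (ε≢ε′ (sym (N-injective
            (act-injective (N ε′) (N ε) v (to-injective f (trans eq′ (sym fεv)))))))
        ... | eq′ | no ε≢ε′  | no ε≢ε₁  =
          trans eq′ (cong (λ ε₂ → act (N ε₂) v) (third ε ε₁ ε′ ε≢ε₁ ε≢ε′))
          where
          third : ∀ a b c → a ≢ b → a ≢ c → b ≡ c
          third pos pos _   a≢b _   = ⊥-elim (a≢b refl)
          third pos neg pos _   a≢c = ⊥-elim (a≢c refl)
          third pos neg neg _   _   = refl
          third neg neg _   a≢b _   = ⊥-elim (a≢b refl)
          third neg pos neg _   a≢c = ⊥-elim (a≢c refl)
          third neg pos pos _   _   = refl

      fixesStar-N : ∀ ε v → FixesStar v → FixesStar (act (N ε) v)
      fixesStar-N ε v (fv , fnb) = fixesStar (act (N ε) v) (opposite ε) (fnb (N ε))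
        (trans (cong (to f) (act-reverse (N ε) v)) (trans fv (sym (act-reverse (N ε) v))))

      N²≢id : ∀ v → act (N pos) (act (N pos) v) ≢ v
      N²≢id (i , s , x) eq = genX≢𝟘 i (x⊕x≡𝟘⇒x≡𝟘 (⊕-identityˡ-unique (genX i ⊕ genX i) x
        (trans (⊕-assoc (genX i) (genX i) x) (cong (proj₂ ∘ proj₂) eq))))

      -- Equality would give 4 `genX i` = 0, impossible for odd p. With `N²≢id` this excludes a
      -- reversal of direction in `fixesStar-S`.
      N²≢N⁻² : ∀ v → act (N pos) (act (N pos) v) ≢ act (N neg) (act (N neg) v)
      N²≢N⁻² (i , s , x) eq = genX≢𝟘 i (x⊕x≡𝟘⇒x≡𝟘 (x≡⊝x⇒x≡𝟘 (begin
        u ⊕ u         ≡⟨ ⊕-cancelʳ x (u ⊕ u) (⊝ u ⊕ ⊝ u) (trans (⊕-assoc u u x)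
                           (trans (cong (proj₂ ∘ proj₂) eq) (sym (⊕-assoc (⊝ u) (⊝ u) x)))) ⟩
        ⊝ u ⊕ ⊝ u     ≡⟨ -‿+-comm u u ⟩
        ⊝ (u ⊕ u)     ∎)))
        where
        open ≡-Reasoning
        u = genX i

      -- The vertex two steps along the cycle from act S v is fixed as well, because its spoke
      -- ends on the cycle of v, and this determines the direction at act S v.
      fixesStar-S : ∀ v → FixesStar v → FixesStar (act S v)
      fixesStar-S v@(i , s , x) (fv , fnb) = fixesStar w pos (fnb S) forward
        where
        w = act S v
        w₂ = act (N pos) (act (N pos) w)
        y = proj₂ (proj₂ w₂)
        w₂-fixed : to f w₂ ≡ w₂
        w₂-fixed = subst (λ r → to f (other i , r , y) ≡ (other i , r , y))
          (sym (genS-involutive (other i) s))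
          (proj₂ (column FixesStar i (λ h → fixesStar-N pos (i , h)) {s} {x} y (fv , fnb)) S)
        forward : to f (act (N pos) w) ≡ act (N pos) w
        forward with image-N f w pos
        ... | pos , eq = trans (sym eq) (cong (act (N pos)) (fnb S))
        ... | neg , eq with image-N f (act (N pos) w) pos
        ...   | pos , eq₂ = ⊥-elim (N²≢id w (begin
            w₂                                      ≡⟨ w₂-fixed ⟨
            to f w₂                                 ≡⟨ eq₂ ⟨
            act (N pos) (to f (act (N pos) w))      ≡⟨ cong (act (N pos)) eq ⟨
            act (N pos) (act (N neg) (to f w))      ≡⟨ act-reverse (N neg) (to f w) ⟩
            to f w                                  ≡⟨ fnb S ⟩
            w                                       ∎))
          where open ≡-Reasoning
        ...   | neg , eq₂ = ⊥-elim (N²≢N⁻² w (begin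
            w₂                                      ≡⟨ w₂-fixed ⟨
            to f w₂                                 ≡⟨ eq₂ ⟨
            act (N neg) (to f (act (N pos) w))      ≡⟨ cong (act (N neg)) eq ⟨
            act (N neg) (act (N neg) (to f w))      ≡⟨ cong (λ y → act (N neg) (act (N neg) y)) (fnb S) ⟩
            act (N neg) (act (N neg) w)             ∎))
          where open ≡-Reasoning

      fixesStar-act : ∀ t v → FixesStar v → FixesStar (act t v)
      fixesStar-act S     = fixesStar-S
      fixesStar-act (N ε) = fixesStar-N ε

      rigid : ∀ v → to f v ≡ v → to f (act (N pos) v) ≡ act (N pos) v → f ≈A idA
      rigid v fv fNv u = proj₁ (reach FixesStar fixesStar-act v u (fixesStar v pos fv fNv))

    agree : ∀ f g v → to f v ≡ to g v → to f (act (N pos) v) ≡ to g (act (N pos) v) → f ≈A g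
    agree f g v eq₀ eq₁ u = begin
      to f u                 ≡⟨ Inverse.strictlyInverseˡ (perm g) (to f u) ⟨
      to g (from g (to f u)) ≡⟨ cong (to g) (Rigid.rigid ((g ⁻¹A) ∘A f) v (pull eq₀) (pull eq₁) u) ⟩
      to g u                 ∎
      where
      open ≡-Reasoning
      pull : ∀ {w} → to f w ≡ to g w → from g (to f w) ≡ w
      pull {w} eq = trans (cong (from g) eq) (Inverse.strictlyInverseʳ (perm g) w)

  -- The automorphisms ρ and δ and the group they generate

  -- The relabelling of steps may vary with the vertex, as `δ` reverses directions on one side only.
  equivariant⇒pres : ∀ (f : V → V) (θ : V → Step → Step) → (∀ t v → f (act t v) ≡ act (θ v t) (f v)) →
                     ∀ u v → Adj u v → Adj (f u) (f v)
  equivariant⇒pres f θ eq u v a with adj⇒act u v a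
  ... | t , refl = subst (Adj (f u)) (sym (eq t u)) (adj-act (θ u t) (f u))

  -- The inverse makes `k ↦ ρ k` a homomorphism, although it multiplies on the right.
  ρ : H → V → V
  ρ k (i , h) = i , h · inv k

  ρ-act : ∀ k t v → ρ k (act t v) ≡ act t (ρ k v)
  ρ-act k S     (i , h) = refl
  ρ-act k (N ε) (i , h) = cong (i ,_) (·-assoc (gen i ε) h (inv k))

  ρ-pres : ∀ k u v → Adj u v → Adj (ρ k u) (ρ k v)
  ρ-pres k = equivariant⇒pres (ρ k) (λ _ t → t) (ρ-act k)

  translation : H → Automorphism
  translation k = mkAut (ρ k) (ρ (inv k))
    (λ (i , h) → cong (i ,_) (HP.//-rightDividesˡ (inv k) h))
    (λ (i , h) → cong (i ,_) (HP.//-rightDividesʳ (inv k) h))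
    (ρ-pres k) (ρ-pres (inv k))

  α : H → H
  α (s , x) = αS s , l ⊛ x

  α-homo : ∀ h k → α (h · k) ≡ α h · α k
  α-homo (s , x) (t , y) = cong₂ _,_ (αS-homo s t) (⊛-distribˡ-⊕ l x y)

  α-e : α e ≡ e
  α-e = cong (eS ,_) (⊛-zeroʳ l)

  α-inv : ∀ h → α (inv h) ≡ inv (α h)
  α-inv h = HP.inverseˡ-unique (α (inv h)) (α h)
    (trans (sym (α-homo (inv h) h)) (trans (cong α (·-inverseˡ h)) α-e))

  α-gen : ∀ i ε → α (gen i ε) ≡ gen (other i) (turn i ε)
  α-gen f0      ε = cong (bS ,_) (trans (⊛-signed ε l 𝟙) (cong (signed ε) (⊛-identityʳ l)))
  α-gen (fs f0) ε = cong (aS ,_) (trans (⊛-signed ε l l) (trans (cong (signed ε) l²) (signed-⊝ ε)))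
    where
    signed-⊝ : ∀ ε → signed ε (⊝ 𝟙) ≡ signed (opposite ε) 𝟙
    signed-⊝ pos = refl
    signed-⊝ neg = ⊝-involutive 𝟙

  bar : H → H
  bar (s , x) = s , ⊝ x

  α² : ∀ h → α (α h) ≡ bar h
  α² (s , x) = cong₂ _,_ (αS-involutive s)
    (trans (sym (⊛-assoc l l x)) (trans (cong (_⊛ x) l²) (-1*x≈-x x)))

  α⁴ : ∀ h → α (α (α (α h))) ≡ h
  α⁴ (s , x) = trans (α² (α (α (s , x)))) (trans (cong bar (α² (s , x))) (cong (s ,_) (⊝-involutive x)))

  δ : V → V
  δ (i , h) = other i , α h

  turnStep : Fin 2 → Step → Step
  turnStep i S     = S
  turnStep i (N ε) = N (turn i ε)

  δ-act : ∀ t v → δ (act t v) ≡ act (turnStep (proj₁ v) t) (δ v)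
  δ-act S     v       = refl
  δ-act (N ε) (i , h) = cong (other i ,_) (trans (α-homo (gen i ε) h) (cong (_· α h) (α-gen i ε)))

  δ⁴ : ∀ v → δ (δ (δ (δ v))) ≡ v
  δ⁴ (f0 , h)    = cong (f0 ,_) (α⁴ h)
  δ⁴ (fs f0 , h) = cong (fs f0 ,_) (α⁴ h)

  δ-pres : ∀ u v → Adj u v → Adj (δ u) (δ v)
  δ-pres = equivariant⇒pres δ (λ v → turnStep (proj₁ v)) δ-act

  -- Conjugation by `δ` acts on translations as `α`; this is the relation of the semidirect product.
  δ-ρ : ∀ k v → δ (ρ k v) ≡ ρ (α k) (δ v)
  δ-ρ k (i , h) = cong (other i ,_) (trans (α-homo h (inv k)) (cong (α h ·_) (α-inv k)))

  sideSwap : Automorphism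
  sideSwap = mkAut δ (δ ∘ δ ∘ δ) δ⁴ δ⁴ δ-pres
    (λ u v → δ-pres (δ (δ u)) (δ (δ v)) ∘ δ-pres (δ u) (δ v) ∘ δ-pres u v)

  rotation : ℕ → Automorphism
  rotation zero    = idA
  rotation (suc n) = sideSwap ∘A rotation n

  rotation-fold : ∀ n v → to (rotation n) v ≡ fold v δ n
  rotation-fold zero    v = refl
  rotation-fold (suc n) v = cong δ (rotation-fold n v)

  rotation-ρ : ∀ n k v → to (rotation n) (ρ k v) ≡ ρ (fold k α n) (to (rotation n) v)
  rotation-ρ zero    k v = refl
  rotation-ρ (suc n) k v = trans (cong δ (rotation-ρ n k v)) (δ-ρ (fold k α n) (to (rotation n) v))

  rotation-+₄ : ∀ i j v → to (rotation (toℕ (_+ₙ_ 4 i j))) v ≡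
                to (rotation (toℕ i)) (to (rotation (toℕ j)) v)
  rotation-+₄ i j v = begin
    to (rotation (toℕ (_+ₙ_ 4 i j))) v                   ≡⟨ rotation-fold (toℕ (_+ₙ_ 4 i j)) v ⟩
    fold v δ (toℕ (_+ₙ_ 4 i j))                          ≡⟨ fold-+₄ δ δ⁴ i j v ⟩
    fold (fold v δ (toℕ j)) δ (toℕ i)                    ≡⟨ cong (λ w → fold w δ (toℕ i)) (rotation-fold (toℕ j) v) ⟨
    fold (to (rotation (toℕ j)) v) δ (toℕ i)             ≡⟨ rotation-fold (toℕ i) _ ⟨
    to (rotation (toℕ i)) (to (rotation (toℕ j)) v)      ∎
    where open ≡-Reasoning

  v₀ : V
  v₀ = f0 , e

  rotation-v₀ : ∀ n → to (rotation n) v₀ ≡ (proj₁ (frame n) , e)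
  rotation-v₀ zero    = refl
  rotation-v₀ (suc n) = trans (cong δ (rotation-v₀ n)) (cong (other (proj₁ (frame n)) ,_) α-e)

  rotation-Nv₀ : ∀ n → to (rotation n) (act (N pos) v₀) ≡ act (N (proj₂ (frame n))) (proj₁ (frame n) , e)
  rotation-Nv₀ zero    = refl
  rotation-Nv₀ (suc n) = begin
    δ (to (rotation n) (act (N pos) v₀))   ≡⟨ cong δ (rotation-Nv₀ n) ⟩
    δ (act (N ε) (i , e))                  ≡⟨ δ-act (N ε) (i , e) ⟩
    act (N (turn i ε)) (other i , α e)     ≡⟨ cong (λ h → act (N (turn i ε)) (other i , h)) α-e ⟩
    act (N (turn i ε)) (other i , e)       ∎
    where
    open ≡-Reasoning
    i = proj₁ (frame n)
    ε = proj₂ (frame n)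

  φ : Fin 4 → H → H
  φ i h = fold h α (toℕ i)

  φ-isAction : IsAction p φ
  φ-isAction = (λ i → homo (toℕ i)) , (λ i → φ (-ₙ_ 4 i) , inverseˡ i , inverseʳ i) , fold-+₄ α α⁴
    where
    open Residues 4 using () renaming (⊕-comm to +₄-comm; ⊝-inverseʳ to -₄-inverseʳ)
    homo : ∀ n h k → fold (h · k) α n ≡ fold h α n · fold k α n
    homo zero    h k = refl
    homo (suc n) h k = trans (cong α (homo n h k)) (α-homo (fold h α n) (fold k α n))
    inverseʳ : ∀ i h → φ i (φ (-ₙ_ 4 i) h) ≡ h
    inverseʳ i h = trans (sym (fold-+₄ α α⁴ i (-ₙ_ 4 i) h)) (cong (λ j → φ j h) (-₄-inverseʳ i))
    inverseˡ : ∀ i h → φ (-ₙ_ 4 i) (φ i h) ≡ h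
    inverseˡ i h = trans (sym (fold-+₄ α α⁴ (-ₙ_ 4 i) i h))
      (cong (λ j → φ j h) (trans (+₄-comm (-ₙ_ 4 i) i) (-₄-inverseʳ i)))

  _⊙_ : H × Fin 4 → H × Fin 4 → H × Fin 4
  _⊙_ = mulSD p φ

  aut : H × Fin 4 → Automorphism
  aut (k , i) = translation k ∘A rotation (toℕ i)

  aut-homo : ∀ a b → aut (a ⊙ b) ≈A (aut a ∘A aut b)
  aut-homo (k , i) (m , j) v = begin
    ρ (k · φ i m) (to (rotation (toℕ (_+ₙ_ 4 i j))) v)
      ≡⟨ cong (ρ (k · φ i m)) (rotation-+₄ i j v) ⟩
    ρ (k · φ i m) (to (rotation (toℕ i)) (to (rotation (toℕ j)) v))
      ≡⟨ ρ-homo k (φ i m) _ ⟩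
    ρ k (ρ (φ i m) (to (rotation (toℕ i)) (to (rotation (toℕ j)) v)))
      ≡⟨ cong (ρ k) (rotation-ρ (toℕ i) m _) ⟨
    ρ k (to (rotation (toℕ i)) (ρ m (to (rotation (toℕ j)) v)))
      ∎
    where
    open ≡-Reasoning
    ρ-homo : ∀ k m v → ρ (k · m) v ≡ ρ k (ρ m v)
    ρ-homo k m (i , h) = cong (i ,_)
      (trans (cong (h ·_) (HP.⁻¹-anti-homo-∙ k m)) (sym (·-assoc h (inv m) (inv k))))

  aut-v₀ : ∀ k i → to (aut (k , i)) v₀ ≡ (proj₁ (frame (toℕ i)) , inv k)
  aut-v₀ k i = trans (cong (ρ k) (rotation-v₀ (toℕ i))) (cong (_ ,_) (·-identityˡ (inv k)))

  aut-Nv₀ : ∀ k i → to (aut (k , i)) (act (N pos) v₀) ≡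
            act (N (proj₂ (frame (toℕ i)))) (proj₁ (frame (toℕ i)) , inv k)
  aut-Nv₀ k i = begin
    ρ k (to (rotation (toℕ i)) (act (N pos) v₀))   ≡⟨ cong (ρ k) (rotation-Nv₀ (toℕ i)) ⟩
    ρ k (act (N ε) (j , e))                        ≡⟨ ρ-act k (N ε) (j , e) ⟩
    act (N ε) (j , e · inv k)                      ≡⟨ cong (λ h → act (N ε) (j , h)) (·-identityˡ (inv k)) ⟩
    act (N ε) (j , inv k)                          ∎
    where
    open ≡-Reasoning
    j = proj₁ (frame (toℕ i))
    ε = proj₂ (frame (toℕ i))

  -- The image of `v₀` reveals `k` and the side, the image of its neighbour reveals the direction,
  -- and side and direction together determine the power of `δ`.
  aut-injective : ∀ a b → aut a ≈A aut b → a ≡ b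
  aut-injective (k , i) (m , j) eq =
    cong₂ _,_ (HP.⁻¹-injective (cong proj₂ at-v₀))
      (trans (sym (index-frame i)) (trans (cong index (cong₂ _,_ (cong proj₁ at-v₀) signs)) (index-frame j)))
    where
    at-v₀ : (proj₁ (frame (toℕ i)) , inv k) ≡ (proj₁ (frame (toℕ j)) , inv m)
    at-v₀ = trans (sym (aut-v₀ k i)) (trans (eq v₀) (aut-v₀ m j))
    signs : proj₂ (frame (toℕ i)) ≡ proj₂ (frame (toℕ j))
    signs = N-injective (act-injective _ _ (proj₁ (frame (toℕ i)) , inv k)
      (trans (sym (aut-Nv₀ k i)) (trans (eq (act (N pos) v₀)) (trans (aut-Nv₀ m j)
        (cong (act (N (proj₂ (frame (toℕ j))))) (sym at-v₀))))))

  vertexTransitive : VertexTransitive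
  vertexTransitive u v = (moving v ∘A (moving u ⁻¹A)) ,
    trans (cong (to (moving v)) (trans (cong (from (moving u)) (sym (moving-v₀ u)))
      (Inverse.strictlyInverseʳ (perm (moving u)) v₀))) (moving-v₀ v)
    where
    moving : V → Automorphism
    -- Only the side has to be right, so the direction `pos` is an arbitrary choice.
    moving (i , h) = aut (inv h , index (i , pos))
    moving-v₀ : ∀ v → to (moving v) v₀ ≡ v
    moving-v₀ (i , h) = trans (aut-v₀ (inv h) (index (i , pos)))
      (cong₂ _,_ (cong proj₁ (frame-index (i , pos))) (HP.⁻¹-involutive h))

  -- Non-symmetry, the full automorphism group, and the absence of a regular subgroup.

  module _ (obs : Obstruction (Vanishes l)) where

    ¬symmetric : ¬ Symmetric
    ¬symmetric sym-arc with sym-arc v₀ (act (N pos) v₀) v₀ (act S v₀) (adj-act (N pos) v₀) (adj-act S v₀)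
    ... | σ , σv₀ , σNv₀ = N↛S obs σ v₀ pos (trans σNv₀ (cong (act S) (sym σv₀)))

    -- Both sides send the base arc to the same arc, and `agree` applies. The `inv h` compensates
    -- for the inverse in `ρ`.
    ≈aut : ∀ σ j h ε → to σ v₀ ≡ (j , h) → act (N ε) (j , h) ≡ to σ (act (N pos) v₀) →
           σ ≈A aut (inv h , index (j , ε))
    ≈aut σ j h ε eq₀ eq₁ = agree obs σ (aut (inv h , index (j , ε))) v₀
      (trans eq₀ (sym (trans (aut-v₀ (inv h) (index (j , ε)))
        (cong₂ _,_ (cong proj₁ (frame-index (j , ε))) (HP.⁻¹-involutive h)))))
      (trans (sym eq₁) (sym (trans (aut-Nv₀ (inv h) (index (j , ε)))
        (cong₂ (λ c k → act (N (proj₂ c)) (proj₁ c , k)) (frame-index (j , ε)) (HP.⁻¹-involutive h)))))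

    coordinates : ∀ σ → ∃ λ a → σ ≈A aut a
    coordinates σ with image-N obs σ v₀ pos
    ... | ε , eq = (inv (proj₂ (to σ v₀)) , index (proj₁ (to σ v₀) , ε)) ,
                   ≈aut σ (proj₁ (to σ v₀)) (proj₂ (to σ v₀)) ε refl eq

    -- The map `Ψ` inverts `aut` up to `_≈A_`, so its properties come from `aut` being injective and
    -- multiplicative.
    autIso : AutIso (H × Fin 4) _⊙_
    autIso = Ψ , cong-Ψ , homo-Ψ , injective-Ψ , surjective-Ψ
      where
      Ψ : Automorphism → H × Fin 4
      Ψ σ = proj₁ (coordinates σ)
      ≈autΨ : ∀ σ → σ ≈A aut (Ψ σ)
      ≈autΨ σ = proj₂ (coordinates σ)
      cong-Ψ : ∀ σ τ → σ ≈A τ → Ψ σ ≡ Ψ τ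
      cong-Ψ σ τ eq = aut-injective (Ψ σ) (Ψ τ) λ v →
        trans (sym (≈autΨ σ v)) (trans (eq v) (≈autΨ τ v))
      homo-Ψ : ∀ σ τ → Ψ (σ ∘A τ) ≡ Ψ σ ⊙ Ψ τ
      homo-Ψ σ τ = aut-injective (Ψ (σ ∘A τ)) (Ψ σ ⊙ Ψ τ) λ v → begin
        to (aut (Ψ (σ ∘A τ))) v           ≡⟨ ≈autΨ (σ ∘A τ) v ⟨
        to σ (to τ v)                     ≡⟨ ≈autΨ σ (to τ v) ⟩
        to (aut (Ψ σ)) (to τ v)           ≡⟨ cong (to (aut (Ψ σ))) (≈autΨ τ v) ⟩
        to (aut (Ψ σ)) (to (aut (Ψ τ)) v) ≡⟨ aut-homo (Ψ σ) (Ψ τ) v ⟨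
        to (aut (Ψ σ ⊙ Ψ τ)) v            ∎
        where open ≡-Reasoning
      injective-Ψ : ∀ σ τ → Ψ σ ≡ Ψ τ → σ ≈A τ
      injective-Ψ σ τ eq v = trans (≈autΨ σ v)
        (trans (cong (λ a → to (aut a) v) eq) (sym (≈autΨ τ v)))
      surjective-Ψ : ∀ a → ∃ λ σ → Ψ σ ≡ a
      surjective-Ψ a = aut a , aut-injective (Ψ (aut a)) a λ v → sym (≈autΨ (aut a) v)

    ¬cayley : ¬ Cayley
    ¬cayley (G , transitive , free) with transitive v₀ (act S v₀)
    ... | σ , σ∈G , σv₀ with image-N obs σ v₀ pos
    -- The test vertex is c on side 0: the square of σ inverts the ℤₚ coordinate, while freeness
    -- makes it the identity, giving 1 = -1 in ℤₚ.
    ... | ε , eq = 𝟙≢𝟘 (x≡⊝x⇒x≡𝟘 (cong (proj₂ ∘ proj₂) (sym (begin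
        (f0 , eS , ⊝ 𝟙)                        ≡⟨ half-turn ε (f0 , eS , 𝟙) ⟨
        to r (to r (f0 , eS , 𝟙))              ≡⟨ cong (to r) (σ≈r (f0 , eS , 𝟙)) ⟨
        to r (to σ (f0 , eS , 𝟙))              ≡⟨ σ≈r (to σ (f0 , eS , 𝟙)) ⟨
        to σ (to σ (f0 , eS , 𝟙))              ≡⟨ free (σ ∘A σ) idA v₀ (mem-∘ G {σ} {σ} σ∈G σ∈G) (mem-id G) σ²v₀
                                                    (f0 , eS , 𝟙) ⟩
        (f0 , eS , 𝟙)                          ∎))))
      where
      open ≡-Reasoning
      r = rotation (toℕ (index (fs f0 , ε)))
      ρ-trivial : ∀ v → ρ (inv e) v ≡ v
      ρ-trivial (i , h) = cong (i ,_)
        (trans (cong (h ·_) (HP.⁻¹-involutive e)) (·-identityʳ h))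
      σ≈r : σ ≈A r
      σ≈r v = trans (≈aut σ (fs f0) e ε σv₀ (trans (cong (act (N ε)) (sym σv₀)) eq) v)
                    (ρ-trivial (to r v))
      half-turn : ∀ ε v → let r = rotation (toℕ (index (fs f0 , ε))) in
                  to r (to r v) ≡ (proj₁ v , bar (proj₂ v))
      half-turn pos (i , h) = cong₂ _,_ (Fin.opposite-involutive i) (α² h)
      -- The square of δ³ is δ⁶ = δ².
      half-turn neg v       = trans (cong (δ ∘ δ) (δ⁴ v)) (half-turn pos v)
      bar-e : bar e ≡ e
      bar-e = trans (sym (α² e)) (trans (cong α α-e) α-e)
      σ²v₀ : to σ (to σ v₀) ≡ v₀
      σ²v₀ = begin
        to σ (to σ v₀)   ≡⟨ σ≈r (to σ v₀) ⟩
        to r (to σ v₀)   ≡⟨ cong (to r) (σ≈r v₀) ⟩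
        to r (to r v₀)   ≡⟨ half-turn ε v₀ ⟩
        (f0 , bar e)     ≡⟨ cong (f0 ,_) bar-e ⟩
        v₀               ∎

theorem5p4 : (p : ℕ) .{{_ : NonZero p}} → Prime p → p % 4 ≡ 1 →
    (λ' : ℕ) → HasOrder4Mod p λ' →
    let open GraphNotions (proj₁ (NC9-12p p λ')) (proj₂ (NC9-12p p λ')) in
    Connected × Cubic × ¬ Symmetric × VertexTransitive × ¬ Cayley ×
    HasOrder (12 * p) ×
    (∃[ φ ] (IsAction p φ × AutIso (Hgrp p × Fin 4) (mulSD p φ)))
theorem5p4 p pr p≡1 λ' ord =
  connected , cubic , ¬symmetric obs , vertexTransitive , ¬cayley obs , hasOrder ,
  φ , φ-isAction , autIso obs
  where
  l² = Field.order4⇒square≡-1 p pr p≡1 λ' ord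
  open Graph p pr p≡1 λ' l²
  obs = obstruction-exists p pr p≡1 l l²
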